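{- There is no Eisenstein lattice equable rhombus; that is, no rhombus with all its vertices in $\mathbb{Z}[\omega]$ is equable.
   Context: A planar polygon is equable if its perimeter equals its area. The Eisenstein lattice is $\mathbb{Z}[\omega]\subset\mathbb{C}$, where $\omega=-\frac12+i\frac{\sqrt3}{2}$. -}

module Defs where

open import Data.Integer.Base as ℤ using (ℤ; +_)
open import Data.Integer.Properties as ℤₚ using ()
open import Data.List.Base using (List; []; _∷_)
open import Data.Nat.Base as ℕ using (ℕ; zero; suc)
open import Data.Nat.Properties as ℕₚ using ()
open import Data.Nat.Coprimality using (1-coprimeTo) renaming (sym to coprime-sym)
open import Data.Product.Base using (_×_; _,_; ∃; ∃₂; proj₁; proj₂)
open import Data.Rational.Base as ℚ using (ℚ; 0ℚ; 1ℚ; ½; mkℚ; *<*; *≤*)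
open import Data.Rational.Properties as ℚₚ using ()
open import Data.Rational.Solver using (module +-*-Solver)
open import Data.Sum.Base using (_⊎_; inj₁; inj₂)
open import Function.Base using (case_of_)
open import Relation.Binary.PropositionalEquality as ≡
  using (_≡_; refl; cong; cong₂; subst; subst₂)
open import Relation.Nullary using (¬_; yes; no; contradiction)

module Estimates where

  open import Data.Rational.Base hiding (ℚ; 0ℚ; 1ℚ; ½; mkℚ; *<*; *≤*)
  open +-*-Solver using (solve; _:=_; _:+_; _:*_; _:-_; :-_)
  open ℚₚ.≤-Reasoning

  ε/2>0 : ∀ {ε} → 0ℚ < ε → 0ℚ < ε * ½
  ε/2>0 {ε} ε>0 = subst (_< ε * ½) (ℚₚ.*-zeroˡ ½) (ℚₚ.*-monoˡ-<-pos ½ ε>0)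

  halves : ∀ ε → ε * ½ + ε * ½ ≡ ε
  halves ε = ≡.trans (≡.sym (ℚₚ.*-distribˡ-+ ε ½ ½)) (ℚₚ.*-identityʳ ε)

  *-mono-≤ : ∀ {p q r s} → 0ℚ ≤ r → 0ℚ ≤ q → p ≤ q → r ≤ s → p * r ≤ q * s
  *-mono-≤ {p} {q} {r} {s} 0≤r 0≤q p≤q r≤s = ℚₚ.≤-trans
    (ℚₚ.*-monoʳ-≤-nonNeg r {{nonNegative 0≤r}} p≤q)
    (ℚₚ.*-monoˡ-≤-nonNeg q {{nonNegative 0≤q}} r≤s)

  0≤p*q : ∀ {p q} → 0ℚ ≤ p → 0ℚ ≤ q → 0ℚ ≤ p * q
  0≤p*q {p} {q} 0≤p 0≤q =
    subst (_≤ p * q) (ℚₚ.*-zeroˡ q) (ℚₚ.*-monoʳ-≤-nonNeg q {{nonNegative 0≤q}} 0≤p)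

  p≤p+q : ∀ {p q} → 0ℚ ≤ q → p ≤ p + q
  p≤p+q {p} {q} 0≤q = subst (_≤ p + q) (ℚₚ.+-identityʳ p) (ℚₚ.+-monoʳ-≤ p 0≤q)

  p<p+q : ∀ {p q} → 0ℚ < q → p < p + q
  p<p+q {p} {q} 0<q = subst (_< p + q) (ℚₚ.+-identityʳ p) (ℚₚ.+-monoʳ-< p 0<q)

  0≤p+q : ∀ {p q} → 0ℚ ≤ p → 0ℚ ≤ q → 0ℚ ≤ p + q
  0≤p+q 0≤p 0≤q = ℚₚ.+-mono-≤ 0≤p 0≤q

  p≤∣p∣ : ∀ p → p ≤ ∣ p ∣
  p≤∣p∣ p with ℚₚ.≤-total 0ℚ p
  ... | inj₁ 0≤p = ℚₚ.≤-reflexive (≡.sym (ℚₚ.0≤p⇒∣p∣≡p 0≤p))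
  ... | inj₂ p≤0 = ℚₚ.≤-trans p≤0 (ℚₚ.0≤∣p∣ p)

  ∣p-q∣≡∣q-p∣ : ∀ p q → ∣ p - q ∣ ≡ ∣ q - p ∣
  ∣p-q∣≡∣q-p∣ p q = ≡.trans
    (cong ∣_∣ (solve 2 (λ p q → p :- q := :- (q :- p)) refl p q))
    (ℚₚ.∣-p∣≡∣p∣ (q - p))

  ∣-∣-least : ∀ {p q} → p ≤ q → - p ≤ q → ∣ p ∣ ≤ q
  ∣-∣-least {p} p≤q -p≤q with ℚₚ.∣p∣≡p∨∣p∣≡-p p
  ... | inj₁ eq = subst (_≤ _) (≡.sym eq) p≤q
  ... | inj₂ eq = subst (_≤ _) (≡.sym eq) -p≤q

  p≤q+r⇒p-q≤r : ∀ {p q r} → p ≤ q + r → p - q ≤ r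
  p≤q+r⇒p-q≤r {p} {q} {r} h = begin
    p - q        ≤⟨ ℚₚ.+-monoˡ-≤ (- q) h ⟩
    q + r - q    ≡⟨ solve 2 (λ q r → q :+ r :- q := r) refl q r ⟩
    r            ∎

  p≤q+∣p-q∣ : ∀ p q → p ≤ q + ∣ p - q ∣
  p≤q+∣p-q∣ p q = begin
    p                ≡⟨ solve 2 (λ p q → p := q :+ (p :- q)) refl p q ⟩
    q + (p - q)      ≤⟨ ℚₚ.+-monoʳ-≤ q (p≤∣p∣ (p - q)) ⟩
    q + ∣ p - q ∣    ∎

  ∣-∣-close : ∀ {p q ε} → p ≤ q + ε → q ≤ p + ε → ∣ p - q ∣ ≤ ε
  ∣-∣-close {p} {q} {ε} p≤ q≤ = ∣-∣-least (p≤q+r⇒p-q≤r p≤)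
    (subst (_≤ ε) (solve 2 (λ p q → q :- p := :- (p :- q)) refl p q) (p≤q+r⇒p-q≤r q≤))

  close⇒≤ : ∀ {p q ε} → ∣ p - q ∣ ≤ ε → p ≤ q + ε
  close⇒≤ {p} {q} h = ℚₚ.≤-trans (p≤q+∣p-q∣ p q) (ℚₚ.+-monoʳ-≤ q h)

  close⇒≥ : ∀ {p q ε} → ∣ p - q ∣ ≤ ε → q ≤ p + ε
  close⇒≥ {p} {q} h = close⇒≤ (subst (_≤ _) (∣p-q∣≡∣q-p∣ p q) h)

  +-close : ∀ {a b c d ε} → ∣ a - c ∣ ≤ ε * ½ → ∣ b - d ∣ ≤ ε * ½ →
            ∣ (a + b) - (c + d) ∣ ≤ ε
  +-close {a} {b} {c} {d} {ε} a~c b~d = begin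
    ∣ (a + b) - (c + d) ∣    ≡⟨ cong ∣_∣ (solve 4 (λ a b c d →
                                  (a :+ b) :- (c :+ d) := (a :- c) :+ (b :- d)) refl a b c d) ⟩
    ∣ (a - c) + (b - d) ∣    ≤⟨ ℚₚ.∣p+q∣≤∣p∣+∣q∣ (a - c) (b - d) ⟩
    ∣ a - c ∣ + ∣ b - d ∣    ≤⟨ ℚₚ.+-mono-≤ a~c b~d ⟩
    ε * ½ + ε * ½            ≡⟨ halves ε ⟩
    ε                        ∎

  neg-close : ∀ {a c ε} → ∣ a - c ∣ ≤ ε → ∣ - a - (- c) ∣ ≤ ε
  neg-close {a} {c} h = subst (_≤ _) (≡.trans (∣p-q∣≡∣q-p∣ a c)
    (cong ∣_∣ (solve 2 (λ a c → c :- a := :- a :- (:- c)) refl a c))) h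

  abs-close : ∀ {a c ε} → ∣ a - c ∣ ≤ ε → ∣ ∣ a ∣ - ∣ c ∣ ∣ ≤ ε
  abs-close {a} {c} {ε} h = ∣-∣-close (half a c h) (half c a (subst (_≤ ε) (∣p-q∣≡∣q-p∣ a c) h))
    where
    half : ∀ a c → ∣ a - c ∣ ≤ ε → ∣ a ∣ ≤ ∣ c ∣ + ε
    half a c h = begin
      ∣ a ∣                  ≡⟨ cong ∣_∣ (solve 2 (λ a c → a := c :+ (a :- c)) refl a c) ⟩
      ∣ c + (a - c) ∣        ≤⟨ ℚₚ.∣p+q∣≤∣p∣+∣q∣ c (a - c) ⟩
      ∣ c ∣ + ∣ a - c ∣      ≤⟨ ℚₚ.+-monoʳ-≤ ∣ c ∣ h ⟩
      ∣ c ∣ + ε              ∎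

  pos-close : ∀ {a c ε} → 0ℚ ≤ ε → ∣ a - c ∣ ≤ ε → ∣ (0ℚ ⊔ a) - (0ℚ ⊔ c) ∣ ≤ ε
  pos-close {a} {c} {ε} 0≤ε h = ∣-∣-close (half a c (close⇒≤ {a} {c} h)) (half c a (close⇒≥ {a} {c} h))
    where
    half : ∀ a c → a ≤ c + ε → 0ℚ ⊔ a ≤ 0ℚ ⊔ c + ε
    half a c h = ℚₚ.⊔-lub
      (0≤p+q (ℚₚ.p≤p⊔q 0ℚ c) 0≤ε)
      (ℚₚ.≤-trans h (ℚₚ.+-monoˡ-≤ ε (ℚₚ.p≤q⊔p 0ℚ c)))

  divide : ∀ {ε B} → 0ℚ < ε → 0ℚ < B → ∃ λ δ → 0ℚ < δ × B * δ ≡ ε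
  divide {ε} {B} ε>0 B>0 = ε * 1/B , δ>0 , B*δ≡ε
    where
    instance
      _ = positive B>0
      _ = ℚₚ.pos⇒nonZero B
      _ = ℚₚ.1/pos⇒pos B
    1/B = 1/ B
    δ>0 = subst (_< ε * 1/B) (ℚₚ.*-zeroˡ 1/B) (ℚₚ.*-monoˡ-<-pos 1/B ε>0)
    B*δ≡ε = begin-equality
      B * (ε * 1/B)    ≡⟨ solve 3 (λ B ε i → B :* (ε :* i) := ε :* (B :* i)) refl B ε 1/B ⟩
      ε * (B * 1/B)    ≡⟨ cong (ε *_) (ℚₚ.*-inverseʳ B) ⟩
      ε * 1ℚ           ≡⟨ ℚₚ.*-identityʳ ε ⟩
      ε                ∎

  *-close : ∀ {a b c d ε B C δ η} → ∣ a ∣ ≤ B → ∣ d ∣ ≤ C → B * δ ≡ ε * ½ → C * η ≡ ε * ½ →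
            ∣ a - c ∣ ≤ η → ∣ b - d ∣ ≤ δ → ∣ a * b - c * d ∣ ≤ ε
  *-close {a} {b} {c} {d} {ε} {B} {C} {δ} {η} ∣a∣≤B ∣d∣≤C Bδ Cη a~c b~d = begin
    ∣ a * b - c * d ∣                        ≡⟨ cong ∣_∣ (solve 4 (λ a b c d →
      a :* b :- c :* d := a :* (b :- d) :+ d :* (a :- c)) refl a b c d) ⟩
    ∣ a * (b - d) + d * (a - c) ∣            ≤⟨ ℚₚ.∣p+q∣≤∣p∣+∣q∣ (a * (b - d)) (d * (a - c)) ⟩
    ∣ a * (b - d) ∣ + ∣ d * (a - c) ∣        ≡⟨ cong₂ _+_ (ℚₚ.∣p*q∣≡∣p∣*∣q∣ a (b - d)) (ℚₚ.∣p*q∣≡∣p∣*∣q∣ d (a - c)) ⟩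
    ∣ a ∣ * ∣ b - d ∣ + ∣ d ∣ * ∣ a - c ∣    ≤⟨ ℚₚ.+-mono-≤
      (*-mono-≤ (ℚₚ.0≤∣p∣ (b - d)) (ℚₚ.≤-trans (ℚₚ.0≤∣p∣ a) ∣a∣≤B) ∣a∣≤B b~d)
      (*-mono-≤ (ℚₚ.0≤∣p∣ (a - c)) (ℚₚ.≤-trans (ℚₚ.0≤∣p∣ d) ∣d∣≤C) ∣d∣≤C a~c) ⟩
    B * δ + C * η                            ≡⟨ cong₂ _+_ Bδ Cη ⟩
    ε * ½ + ε * ½                            ≡⟨ halves ε ⟩
    ε                                        ∎

  1/[1+_] : ℕ → ℚ
  1/[1+ n ] = mkℚ (+ 1) n (1-coprimeTo (suc n))

  1/[1+n]>0 : ∀ n → 0ℚ < 1/[1+ n ]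
  1/[1+n]>0 n = *<* (ℤ.+<+ (ℕ.s≤s ℕ.z≤n))

  archimedean : ∀ {ε} → 0ℚ < ε → ∃ λ N → ∀ n → N ℕ.≤ n → 1/[1+ n ] ≤ ε
  archimedean {mkℚ (+ zero) _ _} (*<* (ℤ.+<+ ()))
  archimedean {mkℚ ℤ.-[1+ _ ] _ _} (*<* ())
  archimedean {mkℚ (+ suc p) d _} _ = d , λ n d≤n →
    *≤* (ℤ.+≤+
      (subst (ℕ._≤ suc p ℕ.* suc n) (≡.sym (ℕₚ.*-identityˡ (suc d)))
        (ℕₚ.≤-trans (ℕ.s≤s d≤n) (ℕₚ.m≤n*m (suc n) (suc p)))))

  -- The largest multiple r = jδ with j ≤ k and r² ≤ q, for q ≥ 0 and δ > 0.
  root : ℚ → ℚ → ℕ → ℚ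
  root q δ zero = 0ℚ
  root q δ (suc k) with (root q δ k + δ) * (root q δ k + δ) ℚₚ.≤? q
  ... | yes _ = root q δ k + δ
  ... | no  _ = root q δ k

  record IsRoot (q δ r : ℚ) : Set where
    constructor isRoot
    field
      nonneg : 0ℚ ≤ r
      lower  : r * r ≤ q
      upper  : q < (r + δ) * (r + δ)

  fromℕ : ℕ → ℚ
  fromℕ n = mkℚ (+ n) 0 (coprime-sym (1-coprimeTo n))

  module _ {q δ : ℚ} (0≤q : 0ℚ ≤ q) (0<δ : 0ℚ < δ) where

    root-nonneg : ∀ k → 0ℚ ≤ root q δ k
    root-nonneg zero = ℚₚ.≤-refl
    root-nonneg (suc k) with (root q δ k + δ) * (root q δ k + δ) ℚₚ.≤? q
    ... | yes _ = 0≤p+q (root-nonneg k) (ℚₚ.<⇒≤ 0<δ)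
    ... | no  _ = root-nonneg k

    root-lower : ∀ k → root q δ k * root q δ k ≤ q
    root-lower zero = 0≤q
    root-lower (suc k) with (root q δ k + δ) * (root q δ k + δ) ℚₚ.≤? q
    ... | yes h = h
    ... | no  _ = root-lower k

    fromℕ-suc : ∀ k → fromℕ (suc k) ≡ fromℕ k + 1ℚ
    fromℕ-suc k = ≡.trans (≡.sym (ℚₚ.normalize-coprime (coprime-sym (1-coprimeTo (suc k)))))
      (ℚₚ./-cong {q₁ = 1} {q₂ = 1} (≡.trans (cong +_ (ℕₚ.+-comm 1 k))
        (cong (ℤ._+ + 1) (≡.sym (ℤₚ.*-identityʳ (+ k))))) refl)

    root-upper : ∀ k → q < (root q δ k + δ) * (root q δ k + δ) ⊎ root q δ k ≡ fromℕ k * δ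
    root-upper zero = inj₂ (≡.sym (ℚₚ.*-zeroˡ δ))
    root-upper (suc k) with (root q δ k + δ) * (root q δ k + δ) ℚₚ.≤? q | root-upper k
    ... | no  h | _      = inj₁ (ℚₚ.≰⇒> h)
    ... | yes h | inj₁ l = contradiction h (λ h → ℚₚ.<-irrefl refl (ℚₚ.<-≤-trans l h))
    ... | yes _ | inj₂ e = inj₂ (begin-equality
      root q δ k + δ         ≡⟨ cong (_+ δ) e ⟩
      fromℕ k * δ + δ        ≡⟨ cong (λ x → fromℕ k * δ + x) (ℚₚ.*-identityˡ δ) ⟨
      fromℕ k * δ + 1ℚ * δ   ≡⟨ ℚₚ.*-distribʳ-+ δ (fromℕ k) 1ℚ ⟨
      (fromℕ k + 1ℚ) * δ     ≡⟨ cong (_* δ) (fromℕ-suc k) ⟨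
      fromℕ (suc k) * δ      ∎)

    root-isRoot : ∀ k → q ≤ fromℕ k * δ → 1ℚ ≤ fromℕ k * δ → IsRoot q δ (root q δ k)
    root-isRoot k q≤kδ 1≤kδ = isRoot (root-nonneg k) (root-lower k) (upper (root-upper k))
      where
      r = root q δ k
      upper : q < (r + δ) * (r + δ) ⊎ r ≡ fromℕ k * δ → q < (r + δ) * (r + δ)
      upper (inj₁ q<) = q<
      upper (inj₂ eq) = begin-strict
        q                          ≡⟨ ℚₚ.*-identityʳ q ⟨
        q * 1ℚ                     ≤⟨ *-mono-≤ (*≤* (ℤ.+≤+ ℕ.z≤n)) (root-nonneg k) q≤r 1≤r ⟩
        r * r                      <⟨ p<p+q (ℚₚ.<-≤-trans 0<δδ (p≤p+q (0≤p+q 0≤rδ 0≤rδ))) ⟩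
        r * r + (δ * δ + (r * δ + r * δ))
                                   ≡⟨ solve 2 (λ r δ → r :* r :+ (δ :* δ :+ (r :* δ :+ r :* δ)) :=
                                        (r :+ δ) :* (r :+ δ)) refl r δ ⟩
        (r + δ) * (r + δ)          ∎
        where
        q≤r = subst (q ≤_) (≡.sym eq) q≤kδ
        1≤r = subst (1ℚ ≤_) (≡.sym eq) 1≤kδ
        0≤rδ = 0≤p*q (root-nonneg k) (ℚₚ.<⇒≤ 0<δ)
        0<δδ = subst (_< δ * δ) (ℚₚ.*-zeroˡ δ) (ℚₚ.*-monoˡ-<-pos δ {{positive 0<δ}} 0<δ)

  -- The square root of q ≥ 0 rounded down to a multiple of 1/(n+1).  Since q is at most
  -- its numerator, the bound on the number of steps is not binding.
  √≈ : ℕ → ℚ → ℚ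
  √≈ n q = root q 1/[1+ n ] (suc n ℕ.* suc ℤ.∣ ↥ q ∣)

  √≈-isRoot : ∀ n {q} → 0ℚ ≤ q → IsRoot q 1/[1+ n ] (√≈ n q)
  √≈-isRoot n {q} 0≤q = root-isRoot 0≤q (1/[1+n]>0 n) (suc n ℕ.* suc P)
    (subst (q ≤_) (≡.sym kδ≡) (q≤num q 0≤q)) (subst (1ℚ ≤_) (≡.sym kδ≡) 1≤)
    where
    P = ℤ.∣ ↥ q ∣
    fromℕ-* : ∀ a b → fromℕ (a ℕ.* b) ≡ fromℕ a * fromℕ b
    fromℕ-* a b = ≡.trans (≡.sym (ℚₚ.normalize-coprime (coprime-sym (1-coprimeTo (a ℕ.* b)))))
      (ℚₚ./-cong {q₁ = 1} {q₂ = 1} (ℤₚ.pos-* a b) refl)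
    kδ≡ : fromℕ (suc n ℕ.* suc P) * 1/[1+ n ] ≡ fromℕ (suc P)
    kδ≡ = begin-equality
      fromℕ (suc n ℕ.* suc P) * 1/[1+ n ]
        ≡⟨ cong (_* 1/[1+ n ]) (fromℕ-* (suc n) (suc P)) ⟩
      fromℕ (suc n) * fromℕ (suc P) * (1/ fromℕ (suc n))
        ≡⟨ solve 3 (λ a b c → a :* b :* c := a :* c :* b) refl (fromℕ (suc n)) (fromℕ (suc P)) (1/ fromℕ (suc n)) ⟩
      fromℕ (suc n) * (1/ fromℕ (suc n)) * fromℕ (suc P)
        ≡⟨ cong (_* fromℕ (suc P)) (ℚₚ.*-inverseʳ (fromℕ (suc n))) ⟩
      1ℚ * fromℕ (suc P)
        ≡⟨ ℚₚ.*-identityˡ (fromℕ (suc P)) ⟩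
      fromℕ (suc P) ∎
    1≤ : 1ℚ ≤ fromℕ (suc P)
    1≤ = *≤* (ℤ.+≤+ (ℕ.s≤s ℕ.z≤n))
    bound : ∀ a d → a ℕ.* 1 ℕ.≤ suc a ℕ.* suc d
    bound a d = ℕₚ.*-mono-≤ (ℕₚ.n≤1+n a) (ℕ.s≤s ℕ.z≤n)
    q≤num : ∀ q → 0ℚ ≤ q → q ≤ fromℕ (suc ℤ.∣ ↥ q ∣)
    q≤num (mkℚ (+ a) d _) _ =
      *≤* (subst₂ ℤ._≤_ (ℤₚ.pos-* a 1) (ℤₚ.pos-* (suc a) (suc d)) (ℤ.+≤+ (bound a d)))
    q≤num (mkℚ ℤ.-[1+ _ ] _ _) (*≤* ())

  square-cancel-< : ∀ {p q} → 0ℚ ≤ q → p * p < q * q → p < q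
  square-cancel-< {p} {q} 0≤q pp<qq with q ℚₚ.≤? p
  ... | no  q≰p = ℚₚ.≰⇒> q≰p
  ... | yes q≤p = contradiction pp<qq
    (λ h → ℚₚ.<-irrefl refl (ℚₚ.<-≤-trans h (*-mono-≤ 0≤q (ℚₚ.≤-trans 0≤q q≤p) q≤p q≤p)))

  √-close : ∀ {a b ε δ δ′ s t} → 0ℚ < ε → IsRoot a δ s → IsRoot b δ′ t →
            0ℚ < δ → 0ℚ < δ′ → δ ≤ ε * ½ → δ′ ≤ ε * ½ → ∣ a - b ∣ ≤ (ε * ½) * (ε * ½) → ∣ s - t ∣ ≤ ε
  √-close {a} {b} {ε} 0<ε s t 0<δ 0<δ′ δ≤ δ′≤ a~b =
    ∣-∣-close (half s t 0<δ′ δ′≤ (close⇒≤ {a} {b} a~b)) (half t s 0<δ δ≤ (close⇒≥ {a} {b} a~b))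
    where
    η = ε * ½
    0≤η = ℚₚ.<⇒≤ (ε/2>0 0<ε)
    half : ∀ {a b δ δ′ s t} → IsRoot a δ s → IsRoot b δ′ t → 0ℚ < δ′ → δ′ ≤ η → a ≤ b + η * η → s ≤ t + ε
    half {a} {b} {δ} {δ′} {s} {t} (isRoot 0≤s ss≤a _) (isRoot 0≤t _ b<) 0<δ′ δ′≤ a≤ =
      subst (λ x → s ≤ t + x) (halves ε) (ℚₚ.<⇒≤ (square-cancel-< 0≤u (begin-strict
        s * s                               ≤⟨ ss≤a ⟩
        a                                   ≤⟨ a≤ ⟩
        b + η * η                           <⟨ ℚₚ.+-monoˡ-< (η * η) b< ⟩
        (t + δ′) * (t + δ′) + η * η         ≤⟨ ℚₚ.+-monoˡ-≤ (η * η) (*-mono-≤ 0≤tδ′ 0≤tη tδ′≤tη tδ′≤tη) ⟩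
        (t + η) * (t + η) + η * η           ≤⟨ p≤p+q (0≤p+q 0≤tηη 0≤tηη) ⟩
        (t + η) * (t + η) + η * η + ((t + η) * η + (t + η) * η)
          ≡⟨ solve 2 (λ t η → (t :+ η) :* (t :+ η) :+ η :* η :+ ((t :+ η) :* η :+ (t :+ η) :* η)
               := (t :+ (η :+ η)) :* (t :+ (η :+ η))) refl t η ⟩
        (t + (η + η)) * (t + (η + η))       ∎)))
      where
      0≤tη = 0≤p+q 0≤t 0≤η
      0≤tηη = 0≤p*q 0≤tη 0≤η
      0≤u = 0≤p+q 0≤t (0≤p+q 0≤η 0≤η)
      0≤tδ′ = 0≤p+q 0≤t (ℚₚ.<⇒≤ 0<δ′)
      tδ′≤tη = ℚₚ.+-monoʳ-≤ t δ′≤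

  0<p*p : ∀ {p} → 0ℚ < p → 0ℚ < p * p
  0<p*p {p} 0<p = subst (_< p * p) (ℚₚ.*-zeroˡ p) (ℚₚ.*-monoˡ-<-pos p {{positive 0<p}} 0<p)

  0<1 : 0ℚ < 1ℚ
  0<1 = *<* (ℤ.+<+ (ℕ.s≤s ℕ.z≤n))

  1/[1+n]≤1 : ∀ n → 1/[1+ n ] ≤ 1ℚ
  1/[1+n]≤1 n = *≤* (ℤ.+≤+ (ℕ.s≤s ℕ.z≤n))

  B+B+1>0 : ∀ {B} → 0ℚ < B → 0ℚ < B + B + 1ℚ
  B+B+1>0 0<B = ℚₚ.+-mono-< (ℚₚ.+-mono-< 0<B 0<B) 0<1

  small : ∀ {δ s B δ′ η} → 0ℚ ≤ δ → δ ≤ 1ℚ → 0ℚ ≤ s → ∣ s ∣ ≤ B → δ ≤ δ′ →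
          (B + B + 1ℚ) * δ′ ≡ η → δ * (s + s + δ) ≤ η
  small {δ} {s} {B} {δ′} {η} 0≤δ δ≤1 0≤s ∣s∣≤B δ≤δ′ eq = begin
    δ * (s + s + δ)       ≤⟨ *-mono-≤ (0≤p+q (0≤p+q 0≤s 0≤s) 0≤δ) (ℚₚ.≤-trans 0≤δ δ≤δ′) δ≤δ′
                               (ℚₚ.+-mono-≤ (ℚₚ.+-mono-≤ s≤B s≤B) δ≤1) ⟩
    δ′ * (B + B + 1ℚ)     ≡⟨ ℚₚ.*-comm δ′ (B + B + 1ℚ) ⟩
    (B + B + 1ℚ) * δ′     ≡⟨ eq ⟩
    η                     ∎
    where s≤B = ℚₚ.≤-trans (p≤∣p∣ s) ∣s∣≤B

  pos≈ : ∀ {x η} → 0ℚ ≤ η → 0ℚ ≤ x + η → ∣ 0ℚ ⊔ x - x ∣ ≤ η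
  pos≈ {x} 0≤η 0≤x+η = ∣-∣-close {0ℚ ⊔ x} {x} (ℚₚ.⊔-lub 0≤x+η (p≤p+q {x} 0≤η))
    (ℚₚ.≤-trans (ℚₚ.p≤q⊔p 0ℚ x) (p≤p+q {0ℚ ⊔ x} 0≤η))

  √-square-close : ∀ {q x δ ε s} → 0ℚ < δ → IsRoot q δ s → δ * (s + s + δ) ≤ ε * ½ →
                   ∣ q - x ∣ ≤ ε * ½ → ∣ s * s - x ∣ ≤ ε
  √-square-close {q} {x} {δ} {ε} {s} 0<δ (isRoot 0≤s ss≤q q<) small q~x = begin
    ∣ s * s - x ∣                    ≡⟨ cong ∣_∣ (solve 3 (λ y q x →
                                          y :- x := (y :- q) :+ (q :- x)) refl (s * s) q x) ⟩
    ∣ (s * s - q) + (q - x) ∣        ≤⟨ ℚₚ.∣p+q∣≤∣p∣+∣q∣ (s * s - q) (q - x) ⟩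
    ∣ s * s - q ∣ + ∣ q - x ∣        ≤⟨ ℚₚ.+-mono-≤ ss~q q~x ⟩
    ε * ½ + ε * ½                    ≡⟨ halves ε ⟩
    ε                                ∎
    where
    0≤ε/2 = ℚₚ.≤-trans (0≤p*q (ℚₚ.<⇒≤ 0<δ) (0≤p+q (0≤p+q 0≤s 0≤s) (ℚₚ.<⇒≤ 0<δ))) small
    ss~q : ∣ s * s - q ∣ ≤ ε * ½
    ss~q = ∣-∣-close (ℚₚ.≤-trans ss≤q (p≤p+q 0≤ε/2)) (begin
      q                                ≤⟨ ℚₚ.<⇒≤ q< ⟩
      (s + δ) * (s + δ)                ≡⟨ solve 2 (λ s δ → (s :+ δ) :* (s :+ δ) :=
                                            s :* s :+ δ :* (s :+ s :+ δ)) refl s δ ⟩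
      s * s + δ * (s + s + δ)          ≤⟨ ℚₚ.+-monoʳ-≤ (s * s) small ⟩
      s * s + ε * ½                    ∎)

open Estimates


IsCauchy : (ℕ → ℚ) → Set
IsCauchy x = ∀ ε → 0ℚ ℚ.< ε → ∃ λ N → ∀ m n → N ℕ.≤ m → N ℕ.≤ n → ℚ.∣ x m ℚ.- x n ∣ ℚ.≤ ε

-- Real numbers are Cauchy sequences of rationals, compared by _≃_ below.
record ℝ : Set where
  constructor real
  field
    seq    : ℕ → ℚ
    cauchy : IsCauchy seq

open ℝ

infix  4 _≃_ _≤_
infixl 6 _+_ _-_
infixl 7 _*_
infix  8 -_

_≃_ : ℝ → ℝ → Set
x ≃ y = ∀ ε → 0ℚ ℚ.< ε → ∃ λ N → ∀ n → N ℕ.≤ n → ℚ.∣ seq x n ℚ.- seq y n ∣ ℚ.≤ ε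

_≤_ : ℝ → ℝ → Set
x ≤ y = ∀ ε → 0ℚ ℚ.< ε → ∃ λ N → ∀ n → N ℕ.≤ n → seq x n ℚ.≤ seq y n ℚ.+ ε

fromℚ : ℚ → ℝ
fromℚ q = real (λ _ → q) λ ε ε>0 → 0 , λ _ _ _ _ →
  subst (ℚ._≤ ε) (≡.sym (cong ℚ.∣_∣ (ℚₚ.+-inverseʳ q))) (ℚₚ.<⇒≤ ε>0)

fromℤ : ℤ → ℝ
fromℤ i = fromℚ (i ℚ./ 1)

0ℝ : ℝ
0ℝ = fromℚ 0ℚ

private
  ⊔ˡ : ∀ {M N n} → M ℕ.⊔ N ℕ.≤ n → M ℕ.≤ n
  ⊔ˡ {M} {N} = ℕₚ.m⊔n≤o⇒m≤o M N

  ⊔ʳ : ∀ {M N n} → M ℕ.⊔ N ℕ.≤ n → N ℕ.≤ n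
  ⊔ʳ {M} {N} = ℕₚ.m⊔n≤o⇒n≤o M N

bounded : ∀ x → ∃₂ λ B N → 0ℚ ℚ.< B × (∀ n → N ℕ.≤ n → ℚ.∣ seq x n ∣ ℚ.≤ B)
bounded x with cauchy x 1ℚ 0<1
... | N , h = ℚ.∣ seq x N ∣ ℚ.+ 1ℚ , N
  , ℚₚ.+-mono-≤-< (ℚₚ.0≤∣p∣ (seq x N)) 0<1
  , λ n N≤n → close⇒≤ {ℚ.∣ seq x n ∣} {ℚ.∣ seq x N ∣}
      (abs-close {seq x n} {seq x N} (h n N N≤n ℕₚ.≤-refl))

_+_ : ℝ → ℝ → ℝ
x + y = real (λ n → seq x n ℚ.+ seq y n) proof
  where
  proof : IsCauchy (λ n → seq x n ℚ.+ seq y n)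
  proof ε ε>0 with cauchy x (ε ℚ.* ½) (ε/2>0 ε>0) | cauchy y (ε ℚ.* ½) (ε/2>0 ε>0)
  ... | M , f | N , g = M ℕ.⊔ N , λ m n ≤m ≤n →
    +-close {seq x m} {seq y m} {seq x n} {seq y n} {ε}
      (f m n (⊔ˡ {M} ≤m) (⊔ˡ {M} ≤n)) (g m n (⊔ʳ {M} ≤m) (⊔ʳ {M} ≤n))

-_ : ℝ → ℝ
- x = real (λ n → ℚ.- seq x n) λ ε ε>0 → proj₁ (cauchy x ε ε>0) , λ m n ≤m ≤n →
  neg-close {seq x m} {seq x n} (proj₂ (cauchy x ε ε>0) m n ≤m ≤n)

_-_ : ℝ → ℝ → ℝ
x - y = x + (- y)

_*_ : ℝ → ℝ → ℝ
x * y = real (λ n → seq x n ℚ.* seq y n) proof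
  where
  proof : IsCauchy (λ n → seq x n ℚ.* seq y n)
  proof ε ε>0 =
    case bounded x of λ { (B , K , B>0 , x≤B) →
    case bounded y of λ { (C , L , C>0 , y≤C) →
    case divide (ε/2>0 ε>0) B>0 of λ { (δ , δ>0 , Bδ) →
    case divide (ε/2>0 ε>0) C>0 of λ { (η , η>0 , Cη) →
    case cauchy x η η>0 of λ { (M , f) →
    case cauchy y δ δ>0 of λ { (N , g) →
    (K ℕ.⊔ L) ℕ.⊔ (M ℕ.⊔ N) , λ m n ≤m ≤n →
      *-close {seq x m} {seq y m} {seq x n} {seq y n} {ε} {B} {C} {δ} {η}
        (x≤B m (⊔ˡ {K} (⊔ˡ {K ℕ.⊔ L} ≤m))) (y≤C n (⊔ʳ {K} (⊔ˡ {K ℕ.⊔ L} ≤n))) Bδ Cη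
        (f m n (⊔ˡ {M} (⊔ʳ {K ℕ.⊔ L} ≤m)) (⊔ˡ {M} (⊔ʳ {K ℕ.⊔ L} ≤n)))
        (g m n (⊔ʳ {M} (⊔ʳ {K ℕ.⊔ L} ≤m)) (⊔ʳ {M} (⊔ʳ {K ℕ.⊔ L} ≤n))) }}}}}}

∣_∣ : ℝ → ℝ
∣ x ∣ = real (λ n → ℚ.∣ seq x n ∣) λ ε ε>0 → proj₁ (cauchy x ε ε>0) , λ m n ≤m ≤n →
  abs-close {seq x m} {seq x n} (proj₂ (cauchy x ε ε>0) m n ≤m ≤n)

-- Negative arguments are sent to 0.
√ : ℝ → ℝ
√ x = real (λ n → √≈ n (0ℚ ℚ.⊔ seq x n)) proof
  where
  proof : IsCauchy (λ n → √≈ n (0ℚ ℚ.⊔ seq x n))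
  proof ε ε>0 with ε/2>0 ε>0
  ... | η>0 with archimedean η>0 | cauchy x ((ε ℚ.* ½) ℚ.* (ε ℚ.* ½)) (0<p*p η>0)
  ... | M , f | N , g = M ℕ.⊔ N , λ m n ≤m ≤n →
    √-close {0ℚ ℚ.⊔ seq x m} {0ℚ ℚ.⊔ seq x n} ε>0
      (√≈-isRoot m (ℚₚ.p≤p⊔q 0ℚ (seq x m))) (√≈-isRoot n (ℚₚ.p≤p⊔q 0ℚ (seq x n)))
      (1/[1+n]>0 m) (1/[1+n]>0 n) (f m (⊔ˡ {M} ≤m)) (f n (⊔ˡ {M} ≤n))
      (pos-close {seq x m} {seq x n} (ℚₚ.<⇒≤ (0<p*p η>0))
        (g m n (⊔ʳ {M} ≤m) (⊔ʳ {M} ≤n)))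

√-nonneg : ∀ x → 0ℝ ≤ √ x
√-nonneg x ε ε>0 = 0 , λ n _ → 0≤p+q
  (IsRoot.nonneg (√≈-isRoot n (ℚₚ.p≤p⊔q 0ℚ (seq x n)))) (ℚₚ.<⇒≤ ε>0)

√-square : ∀ x → 0ℝ ≤ x → √ x * √ x ≃ x
√-square x 0≤x ε ε>0 =
  case bounded (√ x) of λ { (B , K , B>0 , s≤B) →
  case divide (ε/2>0 ε>0) (B+B+1>0 B>0) of λ { (δ , δ>0 , δB) →
  case archimedean δ>0 of λ { (M , f) →
  case 0≤x (ε ℚ.* ½) (ε/2>0 ε>0) of λ { (N , g) →
  K ℕ.⊔ (M ℕ.⊔ N) , λ n ≤n → let r = √≈-isRoot n (ℚₚ.p≤p⊔q 0ℚ (seq x n)) in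
    √-square-close {0ℚ ℚ.⊔ seq x n} {seq x n} {1/[1+ n ]} {ε} {seq (√ x) n} (1/[1+n]>0 n) r
      (small {1/[1+ n ]} {seq (√ x) n} {B} {δ} {ε ℚ.* ½}
        (ℚₚ.<⇒≤ (1/[1+n]>0 n)) (1/[1+n]≤1 n) (IsRoot.nonneg r)
        (s≤B n (⊔ˡ {K} ≤n)) (f n (⊔ˡ {M} (⊔ʳ {K} ≤n))) δB)
      (pos≈ {seq x n} (ℚₚ.<⇒≤ (ε/2>0 ε>0)) (g n (⊔ʳ {M} (⊔ʳ {K} ≤n)))) }}}}

record ℂ : Set where
  constructor _+i_
  field
    re : ℝ
    im : ℝ

open ℂ

infix  4 _≃ᶜ_ _∈ℤ[ω]
infix  5 _+i_
infixl 6 _+ᶜ_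
infixl 7 _*ᶜ_

_≃ᶜ_ : ℂ → ℂ → Set
z ≃ᶜ w = re z ≃ re w × im z ≃ im w

_+ᶜ_ : ℂ → ℂ → ℂ
z +ᶜ w = (re z + re w) +i (im z + im w)

_*ᶜ_ : ℂ → ℂ → ℂ
z *ᶜ w = (re z * re w - im z * im w) +i (re z * im w + im z * re w)

fromℤᶜ : ℤ → ℂ
fromℤᶜ i = fromℤ i +i 0ℝ

ω : ℂ
ω = fromℚ (ℚ.- ½) +i (fromℚ ½ * √ (fromℤ (+ 3)))

-- Since ω² = -1 - ω, the ring ℤ[ω] consists of the elements a + bω.
_∈ℤ[ω] : ℂ → Set
z ∈ℤ[ω] = ∃₂ λ a b → z ≃ᶜ fromℤᶜ a +ᶜ fromℤᶜ b *ᶜ ω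

-- The vertices in cyclic order; every two consecutive ones are joined by an edge.
Polygon : Set
Polygon = List ℂ

cyclicSum : (ℂ → ℂ → ℝ) → Polygon → ℝ
cyclicSum f []       = 0ℝ
cyclicSum f (v ∷ vs) = go v vs
  where
  go : ℂ → List ℂ → ℝ
  go u []       = f u v
  go u (w ∷ ws) = f u w + go w ws

dist : ℂ → ℂ → ℝ
dist z w = √ ((re z - re w) * (re z - re w) + (im z - im w) * (im z - im w))

perimeter : Polygon → ℝ
perimeter = cyclicSum dist

-- The shoelace formula, valid for polygons that do not cross themselves.
area : Polygon → ℝ
area P = fromℚ ½ * ∣ cyclicSum (λ z w → re z * im w - re w * im z) P ∣

Equable : Polygon → Set
Equable P = perimeter P ≃ area P

Collinear : ℂ → ℂ → ℂ → Set
Collinear A B C = (re B - re A) * (im C - im A) ≃ (re C - re A) * (im B - im A)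

-- A quadrilateral with four equal sides.  With no three of its vertices collinear,
-- such a quadrilateral is automatically a parallelogram, hence does not cross itself.
record Rhombus (A B C D : ℂ) : Set where
  field
    AB≃BC : dist A B ≃ dist B C
    BC≃CD : dist B C ≃ dist C D
    CD≃DA : dist C D ≃ dist D A
    ¬ABC  : ¬ Collinear A B C
    ¬BCD  : ¬ Collinear B C D
    ¬CDA  : ¬ Collinear C D A
    ¬DAB  : ¬ Collinear D A B

{-# OPTIONS --safe #-}
module Submission where

-- Let n be the squared side of an equable rhombus with vertices in ℤ[ω], and k the cross
-- product of its diagonals in the basis 1, ω.  Comparing squares of perimeter and area gives
-- 256 n = 3 k².  Equal sides force k = 0 or a parallelogram; in the latter case k = 2 K with K
-- the cross product of two adjacent sides, so 64 n = 3 K², and the Lagrange identity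
-- 4 n² = T² + 3 K² turns this into (32 T)² = 3 K² (3 K² − 1024).  The valuation at 3 of the
-- right side is odd unless K = 0.  So n = 0 in either case, and two vertices coincide.

open import Data.Integer.Base as ℤ using (ℤ; +_; 0ℤ)
open import Data.Integer.Properties as ℤₚ using ()
open import Data.Integer.Solver using () renaming (module +-*-Solver to ℤ-Solver)
open import Data.List.Base using ([]; _∷_)
open import Data.Nat.Base as ℕ using (ℕ; zero; suc)
open import Data.Nat.Coprimality using (1-coprimeTo) renaming (sym to coprime-sym)
open import Data.Nat.Divisibility as ℕᵈ using (divides-refl)
open import Data.Nat.Induction using (<-rec)
open import Data.Nat.Primality using (Prime; prime?; euclidsLemma; prime⇒nonZero; prime⇒nonTrivial)
open import Data.Nat.Properties as ℕₚ using ()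
open import Data.Nat.Solver using () renaming (module +-*-Solver to ℕ-Solver)
open import Data.Product.Base using (_×_; _,_; ∃; proj₁; proj₂)
open import Data.Rational.Base as ℚ using (ℚ; 0ℚ; ½; mkℚ)
open import Data.Rational.Properties as ℚₚ using ()
open import Data.Rational.Solver using () renaming (module +-*-Solver to ℚ-Solver)
open import Data.Sum.Base using (_⊎_; inj₁; inj₂; [_,_]′)
open import Function.Base using (id; _∘_)
open import Relation.Binary.Bundles using (Setoid)
open import Relation.Binary.PropositionalEquality
  using (_≡_; refl; sym; trans; cong; cong₂; subst; subst₂; module ≡-Reasoning)
open import Relation.Nullary using (¬_; yes; no; contradiction)
open import Relation.Nullary.Decidable using (toWitness; from-no)

-- Integer arithmetic: descent at the prime 3 and the norm form of ℤ[ω].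

module Arithmetic where

  open import Data.Integer.Base using (_+_; _*_; _-_; -_; ∣_∣)
  open import Data.Integer.Divisibility.Signed using (_∣_; divides; ∣m⇒∣m*n; ∣ᵤ⇒∣; ∣⇒∣ᵤ; ∣m+n∣m⇒∣n)
  open ≡-Reasoning

  ∣-square : ∀ {p} → Prime p → ∀ n → p ℕᵈ.∣ n ℕ.* n → p ℕᵈ.∣ n
  ∣-square pr n p∣nn = [ id , id ]′ (euclidsLemma n n pr p∣nn)

  -- The p-adic valuation of z² is even, that of p x² c is odd.
  z²≡p*x²*c⇒x≡0 : ∀ {p c} → Prime p → ¬ p ℕᵈ.∣ c →
                  ∀ x z → z ℕ.* z ≡ p ℕ.* (x ℕ.* x ℕ.* c) → x ≡ 0
  z²≡p*x²*c⇒x≡0 {p} {c} pr p∤c = <-rec _ step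
    where
    instance
      _ = prime⇒nonZero pr
      _ = prime⇒nonTrivial pr

    step : ∀ x → (∀ {y} → y ℕ.< x → ∀ z → z ℕ.* z ≡ p ℕ.* (y ℕ.* y ℕ.* c) → y ≡ 0) →
           ∀ z → z ℕ.* z ≡ p ℕ.* (x ℕ.* x ℕ.* c) → x ≡ 0
    step zero _ _ _ = refl
    step x@(suc _) rec z eq with ∣-square pr z (subst (p ℕᵈ.∣_) (sym eq) (ℕᵈ.m∣m*n _))
    -- Here z = w p. Cancelling one factor p leaves x² c = p w², and since p does not divide c, it
    -- divides x.
    ... | divides-refl w with euclidsLemma (x ℕ.* x) c pr p∣xxc
      where
      xxc≡ : x ℕ.* x ℕ.* c ≡ p ℕ.* (w ℕ.* w)
      xxc≡ = ℕₚ.*-cancelˡ-≡ _ _ p (trans (sym eq)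
        (solve 2 (λ w p → (w :* p) :* (w :* p) := p :* (p :* (w :* w))) refl w p))
        where open ℕ-Solver
      p∣xxc = subst (p ℕᵈ.∣_) (sym xxc≡) (ℕᵈ.m∣m*n _)
    ... | inj₂ p∣c  = contradiction p∣c p∤c
    ... | inj₁ p∣xx with ∣-square pr x p∣xx
    ... | ℕᵈ.divides y x≡yp = trans x≡yp (cong (ℕ._* p) y≡0)
      where
      open ℕ-Solver
      instance
        y≢0 : ℕ.NonZero y
        y≢0 = ℕ.≢-nonZero λ { refl → case x≡yp }
          where
          case : ¬ x ≡ 0
          case ()
      -- With x = y p as well, cancelling p twice gives the original equation for y and w. As y ≠ 0
      -- and p > 1, y is smaller than x, and the descent applies.
      ww≡ : w ℕ.* w ≡ p ℕ.* (y ℕ.* y ℕ.* c)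
      ww≡ = ℕₚ.*-cancelˡ-≡ _ _ p (ℕₚ.*-cancelˡ-≡ _ _ p (begin
        p ℕ.* (p ℕ.* (w ℕ.* w))                       ≡⟨ solve 2 (λ w p → p :* (p :* (w :* w)) := (w :* p) :* (w :* p)) refl w p ⟩
        w ℕ.* p ℕ.* (w ℕ.* p)                         ≡⟨ eq ⟩
        p ℕ.* (x ℕ.* x ℕ.* c)                         ≡⟨ cong (λ x → p ℕ.* (x ℕ.* x ℕ.* c)) x≡yp ⟩
        p ℕ.* (y ℕ.* p ℕ.* (y ℕ.* p) ℕ.* c)           ≡⟨ solve 3 (λ y p c → p :* ((y :* p) :* (y :* p) :* c) := p :* (p :* (p :* (y :* y :* c)))) refl y p c ⟩
        p ℕ.* (p ℕ.* (p ℕ.* (y ℕ.* y ℕ.* c)))         ∎))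
      y≡0 = rec (subst (y ℕ.<_) (sym x≡yp) (ℕₚ.m<m*n y p (ℕ.nonTrivial⇒n>1 p))) w ww≡

  3-prime : Prime 3
  3-prime = toWitness {a? = prime? 3} _

  z²≡3*x²*c⇒x≡0 : ∀ x z {c} → ¬ + 3 ∣ c → z * z ≡ + 3 * (x * x * c) → x ≡ 0ℤ
  z²≡3*x²*c⇒x≡0 x z {c} 3∤c eq = ℤₚ.∣i∣≡0⇒i≡0
    (z²≡p*x²*c⇒x≡0 3-prime (3∤c ∘ ∣ᵤ⇒∣) ∣ x ∣ ∣ z ∣ (begin
      ∣ z ∣ ℕ.* ∣ z ∣                         ≡⟨ ℤₚ.abs-* z z ⟨
      ∣ z * z ∣                               ≡⟨ cong ∣_∣ eq ⟩
      ∣ + 3 * (x * x * c) ∣                   ≡⟨ ℤₚ.abs-* (+ 3) (x * x * c) ⟩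
      3 ℕ.* ∣ x * x * c ∣                     ≡⟨ cong (3 ℕ.*_) (ℤₚ.abs-* (x * x) c) ⟩
      3 ℕ.* (∣ x * x ∣ ℕ.* ∣ c ∣)             ≡⟨ cong (λ y → 3 ℕ.* (y ℕ.* ∣ c ∣)) (ℤₚ.abs-* x x) ⟩
      3 ℕ.* (∣ x ∣ ℕ.* ∣ x ∣ ℕ.* ∣ c ∣)       ∎))

  -- The squared modulus of p + qω.
  norm : ℤ → ℤ → ℤ
  norm p q = p * p - p * q + q * q

  -- The oriented area of the parallelogram spanned by p + qω and r + tω, in units of the area √3/2
  -- of the parallelogram on 1 and ω.
  cross : ℤ → ℤ → ℤ → ℤ → ℤ
  cross p q r t = p * t - q * r

  -- Twice the real part of (p + qω) times the conjugate of r + tω.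
  dot : ℤ → ℤ → ℤ → ℤ → ℤ
  dot p q r t = + 2 * p * r - p * t - q * r + + 2 * q * t

  open ℤ-Solver

  private
    :norm : ∀ {n} → Polynomial n → Polynomial n → Polynomial n
    :norm p q = p :* p :- p :* q :+ q :* q

    :cross :dot : ∀ {n} → Polynomial n → Polynomial n → Polynomial n → Polynomial n → Polynomial n
    :cross p q r t = p :* t :- q :* r
    :dot p q r t = con (+ 2) :* p :* r :- p :* t :- q :* r :+ con (+ 2) :* q :* t

  -- For u = p + qω and v = r + tω, `dot` is twice the real part of the conjugate of u times v, and
  -- `cross` times √3 is twice its imaginary part. The identity is 4 |u|² |v|² as a sum of these two
  -- squares.
  lagrange : ∀ p q r t → + 4 * norm p q * norm r t ≡
             dot p q r t * dot p q r t + + 3 * (cross p q r t * cross p q r t)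
  lagrange = solve 4 (λ p q r t → con (+ 4) :* :norm p q :* :norm r t :=
    :dot p q r t :* :dot p q r t :+ con (+ 3) :* (:cross p q r t :* :cross p q r t)) refl

  -- Completing the square, 4 (p² - p q + q²) = (2 p - q)² + 3 q². A zero norm thus gives (2 p - q)²
  -- = 3 q² (-1), and the valuation argument with c = -1 yields q = 0; then p² = 0.
  norm≡0 : ∀ p q → norm p q ≡ 0ℤ → p ≡ 0ℤ × q ≡ 0ℤ
  norm≡0 p q eq with z²≡3*x²*c⇒x≡0 q (+ 2 * p - q) {ℤ.-1ℤ} (from-no (3 ℕᵈ.∣? 1) ∘ ∣⇒∣ᵤ) (begin
      (+ 2 * p - q) * (+ 2 * p - q)             ≡⟨ solve 2 (λ p q → (con (+ 2) :* p :- q) :* (con (+ 2) :* p :- q) :=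
                                                    con (+ 4) :* :norm p q :+ con (+ 3) :* (q :* q :* con ℤ.-1ℤ)) refl p q ⟩
      + 4 * norm p q + + 3 * (q * q * ℤ.-1ℤ)    ≡⟨ cong (λ n → + 4 * n + + 3 * (q * q * ℤ.-1ℤ)) eq ⟩
      0ℤ + + 3 * (q * q * ℤ.-1ℤ)                ≡⟨ ℤₚ.+-identityˡ _ ⟩
      + 3 * (q * q * ℤ.-1ℤ)                     ∎)
  ... | refl = [ id , id ]′ (ℤₚ.i*j≡0⇒i≡0∨j≡0 p (trans
      (solve 1 (λ p → p :* p := :norm p (con 0ℤ)) refl p) eq)) , refl

  -- The two hypotheses are a homogeneous linear system in x and y with determinant 3 k. By Cramer's
  -- rule 3 k x = 3 k y = 0.
  dot≡0⇒cross≡0 : ∀ p q r t x y → dot p q x y ≡ 0ℤ → dot r t x y ≡ 0ℤ →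
                  cross p q r t ≡ 0ℤ ⊎ (x ≡ 0ℤ × y ≡ 0ℤ)
  dot≡0⇒cross≡0 p q r t x y ⊥₁ ⊥₂ = [ inj₁ , (λ x≡0 → [ inj₁ , (λ y≡0 → inj₂ (x≡0 , y≡0)) ]′
    (cancel y cramer₂)) ]′ (cancel x cramer₁)
    where
    k = cross p q r t

    cancel : ∀ z → + 3 * (k * z) ≡ 0ℤ → k ≡ 0ℤ ⊎ z ≡ 0ℤ
    cancel z eq = ℤₚ.i*j≡0⇒i≡0∨j≡0 k ([ (λ ()) , id ]′ (ℤₚ.i*j≡0⇒i≡0∨j≡0 (+ 3) eq))

    vanish : ∀ m n → m * dot p q x y - n * dot r t x y ≡ 0ℤ
    vanish m n rewrite ⊥₁ | ⊥₂ = solve 2 (λ m n → m :* con 0ℤ :- n :* con 0ℤ := con 0ℤ) refl m n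

    cramer₁ : + 3 * (k * x) ≡ 0ℤ
    cramer₁ = trans (solve 6 (λ p q r t x y → con (+ 3) :* (:cross p q r t :* x) :=
      (con (+ 2) :* t :- r) :* :dot p q x y :- (con (+ 2) :* q :- p) :* :dot r t x y)
      refl p q r t x y) (vanish (+ 2 * t - r) (+ 2 * q - p))

    cramer₂ : + 3 * (k * y) ≡ 0ℤ
    cramer₂ = trans (solve 6 (λ p q r t x y → con (+ 3) :* (:cross p q r t :* y) :=
      (t :- con (+ 2) :* r) :* :dot p q x y :- (q :- con (+ 2) :* p) :* :dot r t x y)
      refl p q r t x y) (vanish (t - + 2 * r) (q - + 2 * p))

  -- When the sides are equal, the defect B + D − A − C of the parallelogram law is
  -- orthogonal to both diagonals.
  flat-or-parallelogram : ∀ a a′ b b′ c c′ d d′ →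
    norm (a - b) (a′ - b′) ≡ norm (b - c) (b′ - c′) →
    norm (b - c) (b′ - c′) ≡ norm (c - d) (c′ - d′) →
    norm (c - d) (c′ - d′) ≡ norm (d - a) (d′ - a′) →
    cross (c - a) (c′ - a′) (d - b) (d′ - b′) ≡ 0ℤ ⊎
    (d ≡ a + c - b × d′ ≡ a′ + c′ - b′)
  flat-or-parallelogram a a′ b b′ c c′ d d′ AB≡BC BC≡CD CD≡DA =
    [ inj₁ , (λ { (s≡0 , s′≡0) → inj₂ (move a b c d s≡0 , move a′ b′ c′ d′ s′≡0) }) ]′
    (dot≡0⇒cross≡0 (c - a) (c′ - a′) (d - b) (d′ - b′) (b + d - a - c) (b′ + d′ - a′ - c′) ⊥₁ ⊥₂)
    where
    move : ∀ a b c d → b + d - a - c ≡ 0ℤ → d ≡ a + c - b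
    move a b c d eq = begin
      d                                 ≡⟨ solve 4 (λ a b c d → d := (b :+ d :- a :- c) :+ (a :+ c :- b)) refl a b c d ⟩
      (b + d - a - c) + (a + c - b)     ≡⟨ cong (_+ (a + c - b)) eq ⟩
      0ℤ + (a + c - b)                  ≡⟨ ℤₚ.+-identityˡ _ ⟩
      a + c - b                         ∎

    -- B and D are equidistant from A and C, so their offsets from the midpoint of AC are orthogonal
    -- to AC; these offsets add up to the defect. For `⊥₂` the two diagonals exchange roles.
    ⊥₁ : dot (c - a) (c′ - a′) (b + d - a - c) (b′ + d′ - a′ - c′) ≡ 0ℤ
    ⊥₁ = begin
      dot (c - a) (c′ - a′) (b + d - a - c) (b′ + d′ - a′ - c′)
        ≡⟨ solve 8 (λ a a′ b b′ c c′ d d′ →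
             :dot (c :- a) (c′ :- a′) (b :+ d :- a :- c) (b′ :+ d′ :- a′ :- c′) :=
             (:norm (a :- b) (a′ :- b′) :- :norm (b :- c) (b′ :- c′)) :-
             (:norm (c :- d) (c′ :- d′) :- :norm (d :- a) (d′ :- a′))) refl a a′ b b′ c c′ d d′ ⟩
      (norm (a - b) (a′ - b′) - norm (b - c) (b′ - c′)) -
      (norm (c - d) (c′ - d′) - norm (d - a) (d′ - a′))
        ≡⟨ cong₂ _-_ (ℤₚ.i≡j⇒i-j≡0 AB≡BC) (ℤₚ.i≡j⇒i-j≡0 CD≡DA) ⟩
      0ℤ ∎

    ⊥₂ : dot (d - b) (d′ - b′) (b + d - a - c) (b′ + d′ - a′ - c′) ≡ 0ℤ
    ⊥₂ = begin
      dot (d - b) (d′ - b′) (b + d - a - c) (b′ + d′ - a′ - c′)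
        ≡⟨ solve 8 (λ a a′ b b′ c c′ d d′ →
             :dot (d :- b) (d′ :- b′) (b :+ d :- a :- c) (b′ :+ d′ :- a′ :- c′) :=
             (:norm (d :- a) (d′ :- a′) :- :norm (a :- b) (a′ :- b′)) :-
             (:norm (b :- c) (b′ :- c′) :- :norm (c :- d) (c′ :- d′))) refl a a′ b b′ c c′ d d′ ⟩
      (norm (d - a) (d′ - a′) - norm (a - b) (a′ - b′)) -
      (norm (b - c) (b′ - c′) - norm (c - d) (c′ - d′))
        ≡⟨ cong₂ _-_ (ℤₚ.i≡j⇒i-j≡0 (sym (trans AB≡BC (trans BC≡CD CD≡DA)))) (ℤₚ.i≡j⇒i-j≡0 BC≡CD) ⟩
      0ℤ ∎

  -- Keeping w = 16 a variable keeps the coefficients small for the ring solver.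
  scaled⇒cross≡0 : ∀ w → ¬ + 3 ∣ + 4 * (w * w) → ∀ p q r t → norm p q ≡ norm r t →
    let K = cross p q r t in
    + 4 * w * norm p q ≡ + 3 * (K * K) → K ≡ 0ℤ
  scaled⇒cross≡0 w 3∤4w² p q r t n≡ eq =
    -- Multiplying `lagrange` by 4 w² turns its left side into (4 w n)² = (3 K²)², which leaves (2 w
    -- T)² = 3 K² (3 K² - 4 w²). The last factor is divisible by 3 only if 4 w² is.
    z²≡3*x²*c⇒x≡0 K (+ 2 * w * T) {+ 3 * (K * K) - + 4 * (w * w)} 3∤c (begin
    + 2 * w * T * (+ 2 * w * T)
      ≡⟨ solve 3 (λ w T K → con (+ 2) :* w :* T :* (con (+ 2) :* w :* T) :=
           con (+ 4) :* (w :* w) :* (T :* T :+ con (+ 3) :* (K :* K)) :-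
           con (+ 4) :* (w :* w) :* (con (+ 3) :* (K :* K))) refl w T K ⟩
    + 4 * (w * w) * (T * T + + 3 * (K * K)) - + 4 * (w * w) * (+ 3 * (K * K))
      ≡⟨ cong (λ x → + 4 * (w * w) * x - + 4 * (w * w) * (+ 3 * (K * K))) (lagrange p q r t) ⟨
    + 4 * (w * w) * (+ 4 * n * norm r t) - + 4 * (w * w) * (+ 3 * (K * K))
      ≡⟨ cong (λ x → + 4 * (w * w) * (+ 4 * n * x) - + 4 * (w * w) * (+ 3 * (K * K))) n≡ ⟨
    + 4 * (w * w) * (+ 4 * n * n) - + 4 * (w * w) * (+ 3 * (K * K))
      ≡⟨ solve 3 (λ w n K → con (+ 4) :* (w :* w) :* (con (+ 4) :* n :* n) :- con (+ 4) :* (w :* w) :* K :=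
           (con (+ 4) :* w :* n) :* (con (+ 4) :* w :* n) :- con (+ 4) :* (w :* w) :* K) refl w n (+ 3 * (K * K)) ⟩
    + 4 * w * n * (+ 4 * w * n) - + 4 * (w * w) * (+ 3 * (K * K))
      ≡⟨ cong (λ x → x * x - + 4 * (w * w) * (+ 3 * (K * K))) eq ⟩
    + 3 * (K * K) * (+ 3 * (K * K)) - + 4 * (w * w) * (+ 3 * (K * K))
      ≡⟨ solve 2 (λ w K → con (+ 3) :* (K :* K) :* (con (+ 3) :* (K :* K)) :- con (+ 4) :* (w :* w) :* (con (+ 3) :* (K :* K)) :=
           con (+ 3) :* (K :* K :* (con (+ 3) :* (K :* K) :- con (+ 4) :* (w :* w)))) refl w K ⟩
    + 3 * (K * K * (+ 3 * (K * K) - + 4 * (w * w))) ∎)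
    where
    n = norm p q
    K = cross p q r t
    T = dot p q r t

    3∤c : ¬ + 3 ∣ + 3 * (K * K) - + 4 * (w * w)
    3∤c h = 3∤4w² (∣ᵤ⇒∣ (subst (3 ℕᵈ.∣_) (ℤₚ.∣-i∣≡∣i∣ (+ 4 * (w * w)))
      (∣⇒∣ᵤ (∣m+n∣m⇒∣n h (∣m⇒∣m*n (K * K) (divides (+ 1) refl))))))

  equable⇒cross≡0 : ∀ p q r t {k} → norm p q ≡ norm r t → k ≡ + 2 * cross p q r t →
    + 256 * norm p q ≡ + 3 * (k * k) → k ≡ 0ℤ
  equable⇒cross≡0 p q r t n≡ refl eq = cong (+ 2 *_)
    -- 1024 = 4 · 16². Substituting k = 2 K gives 256 n = 12 K², and cancelling 4 leaves 4 w n = 3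
    -- K² at w = 16.
    (scaled⇒cross≡0 (+ 16) (from-no (3 ℕᵈ.∣? 1024) ∘ ∣⇒∣ᵤ) p q r t n≡
      (ℤₚ.*-cancelˡ-≡ (+ 4) (+ 4 * + 16 * n) (+ 3 * (K * K)) (begin
        + 4 * (+ 4 * + 16 * n)          ≡⟨ solve 2 (λ w n → con (+ 4) :* (con (+ 4) :* w :* n) :=
                                             con (+ 4) :* con (+ 4) :* w :* n) refl (+ 16) n ⟩
        + 256 * n                       ≡⟨ eq ⟩
        + 3 * (+ 2 * K * (+ 2 * K))     ≡⟨ solve 1 (λ K → con (+ 3) :* (con (+ 2) :* K :* (con (+ 2) :* K)) :=
                                             con (+ 4) :* (con (+ 3) :* (K :* K))) refl K ⟩
        + 4 * (+ 3 * (K * K))           ∎)))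
    where
    n = norm p q
    K = cross p q r t

  cross≡0⇒norm≡0 : ∀ n {k} → k ≡ 0ℤ → + 256 * n ≡ + 3 * (k * k) → n ≡ 0ℤ
  cross≡0⇒norm≡0 n refl eq = [ (λ ()) , id ]′ (ℤₚ.i*j≡0⇒i≡0∨j≡0 (+ 256) {n} eq)

  -- With sides u = A - B and v = B - C, the diagonals of the parallelogram are -(u + v) and u - v;
  -- bilinearity of the cross product gives the factor 2.
  diagonals : ∀ a a′ b b′ c c′ {d d′} → d ≡ a + c - b → d′ ≡ a′ + c′ - b′ →
    cross (c - a) (c′ - a′) (d - b) (d′ - b′) ≡ + 2 * cross (a - b) (a′ - b′) (b - c) (b′ - c′)
  diagonals a a′ b b′ c c′ refl refl = solve 6 (λ a a′ b b′ c c′ →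
    :cross (c :- a) (c′ :- a′) (a :+ c :- b :- b) (a′ :+ c′ :- b′ :- b′) :=
    con (+ 2) :* :cross (a :- b) (a′ :- b′) (b :- c) (b′ :- c′)) refl a a′ b b′ c c′

  -- Degenerate quadrilaterals satisfy the integer equations, so the conclusion is a coincidence of
  -- vertices, not a contradiction. Both the flat and the parallelogram case lead to k = 0, hence to
  -- a side of norm 0.
  noEquableRhombus : ∀ a a′ b b′ c c′ d d′ →
    norm (a - b) (a′ - b′) ≡ norm (b - c) (b′ - c′) →
    norm (b - c) (b′ - c′) ≡ norm (c - d) (c′ - d′) →
    norm (c - d) (c′ - d′) ≡ norm (d - a) (d′ - a′) →
    let k = cross (c - a) (c′ - a′) (d - b) (d′ - b′) in
    + 256 * norm (a - b) (a′ - b′) ≡ + 3 * (k * k) → a ≡ b × a′ ≡ b′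
  noEquableRhombus a a′ b b′ c c′ d d′ AB≡BC BC≡CD CD≡DA eq =
    let a-b≡0 , a′-b′≡0 = norm≡0 (a - b) (a′ - b′) (cross≡0⇒norm≡0 (norm (a - b) (a′ - b′)) k≡0 eq)
    in  ℤₚ.i-j≡0⇒i≡j a b a-b≡0 , ℤₚ.i-j≡0⇒i≡j a′ b′ a′-b′≡0
    where
    k≡0 : cross (c - a) (c′ - a′) (d - b) (d′ - b′) ≡ 0ℤ
    k≡0 = [ id , (λ (d≡ , d′≡) → equable⇒cross≡0 (a - b) (a′ - b′) (b - c) (b′ - c′)
      AB≡BC (diagonals a a′ b b′ c c′ d≡ d′≡) eq) ]′
      (flat-or-parallelogram a a′ b b′ c c′ d d′ AB≡BC BC≡CD CD≡DA)

-- The Cauchy reals as a setoid with congruent operations.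

open import Defs as Reals hiding (_+_; _-_; _*_; -_)

open ℝ
open ℂ
open ℚ-Solver

-- The type checker would unfold the proofs that the sums and products in Defs are Cauchy
-- sequences; the operations below hide them.
opaque
  +-cauchy : ∀ x y → IsCauchy (λ n → seq x n ℚ.+ seq y n)
  +-cauchy x y = cauchy (x Reals.+ y)

  *-cauchy : ∀ x y → IsCauchy (λ n → seq x n ℚ.* seq y n)
  *-cauchy x y = cauchy (x Reals.* y)

  neg-cauchy : ∀ x → IsCauchy (λ n → ℚ.- seq x n)
  neg-cauchy x = cauchy (Reals.- x)

infixl 6 _+_ _-_
infixl 7 _*_
infix  8 -_

_+_ : ℝ → ℝ → ℝ
x + y = real (λ n → seq x n ℚ.+ seq y n) (+-cauchy x y)

_*_ : ℝ → ℝ → ℝ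
x * y = real (λ n → seq x n ℚ.* seq y n) (*-cauchy x y)

-_ : ℝ → ℝ
- x = real (λ n → ℚ.- seq x n) (neg-cauchy x)

_-_ : ℝ → ℝ → ℝ
x - y = x + (- y)

-- A record, unlike _≃_, lets the related numbers be inferred from the type of a proof.
infix 4 _≈_
record _≈_ (x y : ℝ) : Set where
  constructor ≃⇒≈
  field
    ≈⇒≃ : x ≃ y

open _≈_

-- The operations act term by term, so ring identities between reals reduce to the rational ring
-- solver at each index.
pointwise : ∀ {x y} → (∀ n → seq x n ≡ seq y n) → x ≈ y
pointwise {x} {y} x≡y = ≃⇒≈ λ ε ε>0 → 0 , λ n _ → begin
  ℚ.∣ seq x n ℚ.- seq y n ∣     ≡⟨ cong (λ q → ℚ.∣ q ℚ.- seq y n ∣) (x≡y n) ⟩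
  ℚ.∣ seq y n ℚ.- seq y n ∣     ≡⟨ cong ℚ.∣_∣ (ℚₚ.+-inverseʳ (seq y n)) ⟩
  0ℚ                            ≤⟨ ℚₚ.<⇒≤ ε>0 ⟩
  ε                             ∎
  where open ℚₚ.≤-Reasoning

≈-refl : ∀ {x} → x ≈ x
≈-refl = pointwise λ _ → refl

≈-sym : ∀ {x y} → x ≈ y → y ≈ x
≈-sym {x} {y} (≃⇒≈ x≃y) = ≃⇒≈ λ ε ε>0 → let N , h = x≃y ε ε>0 in N , λ n N≤n →
  subst (ℚ._≤ ε) (Estimates.∣p-q∣≡∣q-p∣ (seq x n) (seq y n)) (h n N≤n)

private
  both : ∀ {P Q : ℕ → Set} → (∃ λ M → ∀ n → M ℕ.≤ n → P n) → (∃ λ N → ∀ n → N ℕ.≤ n → Q n) →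
         ∃ λ K → ∀ n → K ℕ.≤ n → P n × Q n
  both (M , f) (N , g) = M ℕ.⊔ N , λ n ≤n →
    f n (ℕₚ.m⊔n≤o⇒m≤o M N ≤n) , g n (ℕₚ.m⊔n≤o⇒n≤o M N ≤n)

≈-trans : ∀ {x y z} → x ≈ y → y ≈ z → x ≈ z
≈-trans {x} {y} {z} (≃⇒≈ x≃y) (≃⇒≈ y≃z) = ≃⇒≈ λ ε ε>0 →
  let N , h = both (x≃y (ε ℚ.* ½) (Estimates.ε/2>0 ε>0)) (y≃z (ε ℚ.* ½) (Estimates.ε/2>0 ε>0))
  in  N , λ n N≤n → let x~y , y~z = h n N≤n in
  subst (λ q → ℚ.∣ q ∣ ℚ.≤ ε)
    (solve 3 (λ x y z → (x :+ y) :- (y :+ z) := x :- z) refl (seq x n) (seq y n) (seq z n))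
    (Estimates.+-close {seq x n} {seq y n} {seq y n} {seq z n} x~y y~z)

ℝ-setoid : Setoid _ _
ℝ-setoid = record
  { Carrier = ℝ
  ; _≈_ = _≈_
  ; isEquivalence = record { refl = ≈-refl ; sym = ≈-sym ; trans = ≈-trans }
  }

open import Relation.Binary.Reasoning.Setoid ℝ-setoid

+-cong : ∀ {x x′ y y′} → x ≈ x′ → y ≈ y′ → x + y ≈ x′ + y′
+-cong {x} {x′} {y} {y′} (≃⇒≈ x≃x′) (≃⇒≈ y≃y′) = ≃⇒≈ λ ε ε>0 →
  let N , h = both (x≃x′ (ε ℚ.* ½) (Estimates.ε/2>0 ε>0)) (y≃y′ (ε ℚ.* ½) (Estimates.ε/2>0 ε>0))
  in  N , λ n N≤n → let x~x′ , y~y′ = h n N≤n in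
  Estimates.+-close {seq x n} {seq y n} {seq x′ n} {seq y′ n} x~x′ y~y′

*-cong : ∀ {x x′ y y′} → x ≈ x′ → y ≈ y′ → x * y ≈ x′ * y′
*-cong {x} {x′} {y} {y′} (≃⇒≈ x≃x′) (≃⇒≈ y≃y′) = ≃⇒≈ λ ε ε>0 →
  -- Bounds on x and y′ suffice because x y - x′ y′ = x (y - y′) + y′ (x - x′).
  let B , K , B>0 , x≤B = bounded x
      C , L , C>0 , y≤C = bounded y′
      δ , δ>0 , Bδ = Estimates.divide (Estimates.ε/2>0 ε>0) B>0
      η , η>0 , Cη = Estimates.divide (Estimates.ε/2>0 ε>0) C>0
      N , h = both (both (K , x≤B) (L , y≤C)) (both (x≃x′ η η>0) (y≃y′ δ δ>0))
  in  N , λ n N≤n → let (∣x∣≤B , ∣y∣≤C) , (x~x′ , y~y′) = h n N≤n in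
  Estimates.*-close {seq x n} {seq y n} {seq x′ n} {seq y′ n} {ε} {B} {C} {δ} {η}
    ∣x∣≤B ∣y∣≤C Bδ Cη x~x′ y~y′

neg-cong : ∀ {x x′} → x ≈ x′ → - x ≈ - x′
neg-cong {x} {x′} (≃⇒≈ x≃x′) = ≃⇒≈ λ ε ε>0 → let N , h = x≃x′ ε ε>0 in N , λ n N≤n →
  Estimates.neg-close {seq x n} {seq x′ n} (h n N≤n)

−-cong : ∀ {x x′ y y′} → x ≈ x′ → y ≈ y′ → x - y ≈ x′ - y′
−-cong x≈x′ y≈y′ = +-cong x≈x′ (neg-cong y≈y′)

-- If δ = |p - q| were positive, the tolerance δ/2 would give δ ≤ δ/2 for the constant sequences.
-- This is the passage from real equations back to exact ones.
fromℚ-injective : ∀ {p q} → fromℚ p ≈ fromℚ q → p ≡ q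
fromℚ-injective {p} {q} (≃⇒≈ p≃q) with 0ℚ ℚₚ.<? ℚ.∣ p ℚ.- q ∣
... | no  0≮δ = begin′
  where
  δ≡0 : ℚ.∣ p ℚ.- q ∣ ≡ 0ℚ
  δ≡0 = ℚₚ.≤-antisym (ℚₚ.≮⇒≥ 0≮δ) (ℚₚ.0≤∣p∣ (p ℚ.- q))
  begin′ : p ≡ q
  begin′ = trans (solve 2 (λ p q → p := (p :- q) :+ q) refl p q)
    (trans (cong (ℚ._+ q) (ℚₚ.∣p∣≡0⇒p≡0 (p ℚ.- q) δ≡0)) (ℚₚ.+-identityˡ q))
... | yes δ>0 = contradiction (proj₂ (p≃q (δ ℚ.* ½) (Estimates.ε/2>0 δ>0)) _ ℕₚ.≤-refl)
  (λ δ≤δ/2 → ℚₚ.<-irrefl refl (ℚₚ.<-≤-trans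
    (subst (δ ℚ.* ½ ℚ.<_) (Estimates.halves δ) (Estimates.p<p+q (Estimates.ε/2>0 δ>0))) δ≤δ/2))
  where δ = ℚ.∣ p ℚ.- q ∣

∣p∣*∣p∣≡p*p : ∀ p → ℚ.∣ p ∣ ℚ.* ℚ.∣ p ∣ ≡ p ℚ.* p
∣p∣*∣p∣≡p*p p with ℚₚ.∣p∣≡p∨∣p∣≡-p p
... | inj₁ eq rewrite eq = refl
... | inj₂ eq rewrite eq = solve 1 (λ p → (:- p) :* (:- p) := p :* p) refl p

0≤p*p : ∀ p → 0ℚ ℚ.≤ p ℚ.* p
0≤p*p p = subst (0ℚ ℚ.≤_) (∣p∣*∣p∣≡p*p p) (Estimates.0≤p*q (ℚₚ.0≤∣p∣ p) (ℚₚ.0≤∣p∣ p))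

pointwise-nonneg : ∀ {x} → (∀ n → 0ℚ ℚ.≤ seq x n) → 0ℝ ≤ x
pointwise-nonneg 0≤x ε ε>0 = 0 , λ n _ → Estimates.0≤p+q (0≤x n) (ℚₚ.<⇒≤ ε>0)

-- The embedding of ℤ in ℚ.

ι : ℤ → ℚ
ι i = i ℚ./ 1

-- The quotient `i ℚ./ 1` is normalised by cases on `i` and is stuck on a variable; the explicit
-- fraction exposes numerator and denominator to the arithmetic of ℚ.
ι≡mkℚ : ∀ i → ι i ≡ mkℚ i 0 (coprime-sym (1-coprimeTo ℤ.∣ i ∣))
ι≡mkℚ i = ℚₚ.fromℚᵘ-toℚᵘ (mkℚ i 0 (coprime-sym (1-coprimeTo ℤ.∣ i ∣)))

ι-+ : ∀ i j → ι (i ℤ.+ j) ≡ ι i ℚ.+ ι j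
ι-+ i j = sym (trans (cong₂ ℚ._+_ (ι≡mkℚ i) (ι≡mkℚ j))
  (cong ι (cong₂ ℤ._+_ (ℤₚ.*-identityʳ i) (ℤₚ.*-identityʳ j))))

ι-* : ∀ i j → ι (i ℤ.* j) ≡ ι i ℚ.* ι j
ι-* i j = sym (cong₂ ℚ._*_ (ι≡mkℚ i) (ι≡mkℚ j))

ι-neg : ∀ i → ι (ℤ.- i) ≡ ℚ.- ι i
ι-neg i = trans (ι≡mkℚ (ℤ.- i)) (trans (neg i) (cong ℚ.-_ (sym (ι≡mkℚ i))))
  where
  neg : ∀ i → mkℚ (ℤ.- i) 0 (coprime-sym (1-coprimeTo ℤ.∣ ℤ.- i ∣)) ≡
        ℚ.- mkℚ i 0 (coprime-sym (1-coprimeTo ℤ.∣ i ∣))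
  neg (+ zero)    = refl
  neg (+ suc _)   = refl
  neg ℤ.-[1+ _ ]  = refl

ι-− : ∀ i j → ι (i ℤ.- j) ≡ ι i ℚ.- ι j
ι-− i j = trans (ι-+ i (ℤ.- j)) (cong (ι i ℚ.+_) (ι-neg j))

ι-injective : ∀ {i j} → ι i ≡ ι j → i ≡ j
ι-injective {i} {j} eq = cong ℚ.numerator (trans (sym (ι≡mkℚ i)) (trans eq (ι≡mkℚ j)))

open Arithmetic using (norm; cross)

ι-norm : ∀ p q → ι (norm p q) ≡ ι p ℚ.* ι p ℚ.- ι p ℚ.* ι q ℚ.+ ι q ℚ.* ι q
ι-norm p q rewrite ι-+ (p ℤ.* p ℤ.- p ℤ.* q) (q ℤ.* q) | ι-− (p ℤ.* p) (p ℤ.* q)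
                 | ι-* p p | ι-* p q | ι-* q q = refl

ι-cross : ∀ p q r t → ι (cross p q r t) ≡ ι p ℚ.* ι t ℚ.- ι q ℚ.* ι r
ι-cross p q r t rewrite ι-− (p ℤ.* t) (q ℤ.* r) | ι-* p t | ι-* q r = refl

-- Eisenstein coordinates and squared distances.

3ℚ : ℚ
3ℚ = ι (+ 3)

-- Opaque for the same reason.
opaque
  √3 : ℝ
  √3 = √ (fromℤ (+ 3))

  √3≡√3 : √3 ≡ √ (fromℤ (+ 3))
  √3≡√3 = refl

  √3*√3≈3 : √3 * √3 ≈ fromℚ 3ℚ
  √3*√3≈3 = ≃⇒≈ (√-square (fromℤ (+ 3)) (pointwise-nonneg {fromℤ (+ 3)} λ _ → ℚ.*≤* (ℤ.+≤+ ℕ.z≤n)))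

fromℚ-* : ∀ p q → fromℚ p * fromℚ q ≈ fromℚ (p ℚ.* q)
fromℚ-* p q = pointwise λ _ → refl

-- Squared lengths and squared areas involve √3 only through its square; this makes them rational.
fromℚ+√3²-multiple : ∀ p q → fromℚ p + fromℚ q * (√3 * √3) ≈ fromℚ (p ℚ.+ q ℚ.* 3ℚ)
fromℚ+√3²-multiple p q = begin
  fromℚ p + fromℚ q * (√3 * √3)      ≈⟨ +-cong ≈-refl (*-cong ≈-refl √3*√3≈3) ⟩
  fromℚ p + fromℚ q * fromℚ 3ℚ       ≈⟨ pointwise (λ _ → refl) ⟩
  fromℚ (p ℚ.+ q ℚ.* 3ℚ)             ∎

-- This is a + bω = (a - b/2) + (b/2) √3 i, with the opaque `√3` and without the zero terms that
-- complex multiplication leaves.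
record Coordinates (z : ℂ) (a b : ℤ) : Set where
  field
    re≈ : re z ≈ fromℚ (ι a ℚ.- ½ ℚ.* ι b)
    im≈ : im z ≈ fromℚ (½ ℚ.* ι b) * √3

open Coordinates

coordinates : ∀ {z a b} → z ≃ᶜ fromℤᶜ a +ᶜ fromℤᶜ b *ᶜ ω → Coordinates z a b
coordinates {z} {a} {b} (re≃ , im≃) = record
  { re≈ = ≈-trans {y = re w} (≃⇒≈ re≃) (pointwise λ n →
      solve 3 (λ a b s → a :+ (b :* con (ℚ.- ½) :- con 0ℚ :* (con ½ :* s)) := a :- con ½ :* b)
        refl (ι a) (ι b) (seq (√ (fromℤ (+ 3))) n))
  ; im≈ = ≈-trans {y = im w} (≃⇒≈ im≃) (pointwise λ n → trans
      (solve 2 (λ b s → con 0ℚ :+ (b :* (con ½ :* s) :+ con 0ℚ :* con (ℚ.- ½)) := con ½ :* b :* s)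
        refl (ι b) (seq (√ (fromℤ (+ 3))) n))
      (cong (λ s → ½ ℚ.* ι b ℚ.* seq s n) (sym √3≡√3)))
  }
  where w = fromℤᶜ a +ᶜ fromℤᶜ b *ᶜ ω

dist² : ∀ z w → dist z w * dist z w ≈
        (re z - re w) * (re z - re w) + (im z - im w) * (im z - im w)
dist² z w = ≃⇒≈ (√-square sumOfSquares (pointwise-nonneg {sumOfSquares} λ n →
  Estimates.0≤p+q (0≤p*p (seq (re z - re w) n)) (0≤p*p (seq (im z - im w) n))))
  where
  sumOfSquares = (re z - re w) * (re z - re w) + (im z - im w) * (im z - im w)

-- For x = a - c and y = b - d, (x - y/2)² + 3 (y/2)² = x² - x y + y².
dist²≈norm : ∀ {z w a b c d} → Coordinates z a b → Coordinates w c d →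
             dist z w * dist z w ≈ fromℚ (ι (norm (a ℤ.- c) (b ℤ.- d)))
dist²≈norm {z} {w} {a} {b} {c} {d} Z W = begin
  dist z w * dist z w
    ≈⟨ dist² z w ⟩
  (re z - re w) * (re z - re w) + (im z - im w) * (im z - im w)
    ≈⟨ +-cong (*-cong Δre Δre) (*-cong Δim Δim) ⟩
  (fromℚ p - fromℚ r) * (fromℚ p - fromℚ r) +
  (fromℚ q * √3 - fromℚ t * √3) * (fromℚ q * √3 - fromℚ t * √3)
    ≈⟨ pointwise (λ n → solve 5 (λ p q r t s →
         (p :- r) :* (p :- r) :+ (q :* s :- t :* s) :* (q :* s :- t :* s) :=
         (p :- r) :* (p :- r) :+ ((q :- t) :* (q :- t)) :* (s :* s)) refl p q r t (seq √3 n)) ⟩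
  fromℚ ((p ℚ.- r) ℚ.* (p ℚ.- r)) + fromℚ ((q ℚ.- t) ℚ.* (q ℚ.- t)) * (√3 * √3)
    ≈⟨ fromℚ+√3²-multiple _ _ ⟩
  fromℚ ((p ℚ.- r) ℚ.* (p ℚ.- r) ℚ.+ (q ℚ.- t) ℚ.* (q ℚ.- t) ℚ.* 3ℚ)
    ≡⟨ cong fromℚ norm≡ ⟩
  fromℚ (ι (norm (a ℤ.- c) (b ℤ.- d))) ∎
  where
  p = ι a ℚ.- ½ ℚ.* ι b
  q = ½ ℚ.* ι b
  r = ι c ℚ.- ½ ℚ.* ι d
  t = ½ ℚ.* ι d
  Δre = −-cong (re≈ Z) (re≈ W)
  Δim = −-cong (im≈ Z) (im≈ W)

  norm≡ : (p ℚ.- r) ℚ.* (p ℚ.- r) ℚ.+ (q ℚ.- t) ℚ.* (q ℚ.- t) ℚ.* 3ℚ ≡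
          ι (norm (a ℤ.- c) (b ℤ.- d))
  norm≡ rewrite ι-norm (a ℤ.- c) (b ℤ.- d) | ι-− a c | ι-− b d =
    solve 4 (λ a b c d →
      let p = a :- con ½ :* b ; q = con ½ :* b ; r = c :- con ½ :* d ; t = con ½ :* d in
      (p :- r) :* (p :- r) :+ (q :- t) :* (q :- t) :* con 3ℚ :=
      (a :- c) :* (a :- c) :- (a :- c) :* (b :- d) :+ (b :- d) :* (b :- d))
      refl (ι a) (ι b) (ι c) (ι d)

-- Squaring removes the roots; both sides are then embedded integers, and the embedding is
-- injective.
sides⇒norms : ∀ {x y z w a a′ b b′ c c′ d d′} →
  Coordinates x a a′ → Coordinates y b b′ → Coordinates z c c′ → Coordinates w d d′ →
  dist x y ≃ dist z w → norm (a ℤ.- b) (a′ ℤ.- b′) ≡ norm (c ℤ.- d) (c′ ℤ.- d′)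
sides⇒norms {x} {y} {z} {w} {a} {a′} {b} {b′} {c} {c′} {d} {d′} X Y Z W eq =
  ι-injective (fromℚ-injective (≈-trans (≈-sym xy²) (≈-trans squares zw²)))
  where
  xy² = dist²≈norm {x} {y} {a} {a′} {b} {b′} X Y
  zw² = dist²≈norm {z} {w} {c} {c′} {d} {d′} Z W
  sides = ≃⇒≈ {dist x y} {dist z w} eq
  squares = *-cong sides sides

-- The shoelace sum and the squared area.

wedge : ℂ → ℂ → ℝ
wedge z w = re z * im w - re w * im z

-- Only the imaginary parts carry `√3`, so it factors out; the two terms in b d cancel.
wedge≈ : ∀ {z w a b c d} → Coordinates z a b → Coordinates w c d →
  wedge z w ≈ fromℚ (½ ℚ.* (ι a ℚ.* ι d ℚ.- ι b ℚ.* ι c)) * √3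
wedge≈ {z} {w} {a} {b} {c} {d} Z W = begin
  re z * im w - re w * im z
    ≈⟨ −-cong (*-cong (re≈ Z) (im≈ W)) (*-cong (re≈ W) (im≈ Z)) ⟩
  fromℚ (ι a ℚ.- ½ ℚ.* ι b) * (fromℚ (½ ℚ.* ι d) * √3) -
  fromℚ (ι c ℚ.- ½ ℚ.* ι d) * (fromℚ (½ ℚ.* ι b) * √3)
    ≈⟨ pointwise (λ n → solve 5 (λ a b c d s →
         (a :- con ½ :* b) :* (con ½ :* d :* s) :- (c :- con ½ :* d) :* (con ½ :* b :* s) :=
         con ½ :* (a :* d :- b :* c) :* s) refl (ι a) (ι b) (ι c) (ι d) (seq √3 n)) ⟩
  fromℚ (½ ℚ.* (ι a ℚ.* ι d ℚ.- ι b ℚ.* ι c)) * √3 ∎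

shoelace : ℂ → ℂ → ℂ → ℂ → ℝ
shoelace A B C D = wedge A B + (wedge B C + (wedge C D + wedge D A))

-- By bilinearity A × B + B × C + C × D + D × A = (C - A) × (D - B), for any quadrilateral: this is
-- where the diagonals enter.
shoelace≈ : ∀ {A B C D a a′ b b′ c c′ d d′} →
  Coordinates A a a′ → Coordinates B b b′ → Coordinates C c c′ → Coordinates D d d′ →
  shoelace A B C D ≈ fromℚ (½ ℚ.* ι (cross (c ℤ.- a) (c′ ℤ.- a′) (d ℤ.- b) (d′ ℤ.- b′))) * √3
shoelace≈ {a = a} {a′} {b} {b′} {c} {c′} {d} {d′} Aᶜ Bᶜ Cᶜ Dᶜ = ≈-trans terms (pointwise λ n → trans
  (solve 9 (λ a a′ b b′ c c′ d d′ s →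
    con ½ :* (a :* b′ :- a′ :* b) :* s :+ (con ½ :* (b :* c′ :- b′ :* c) :* s :+
    (con ½ :* (c :* d′ :- c′ :* d) :* s :+ con ½ :* (d :* a′ :- d′ :* a) :* s)) :=
    con ½ :* ((c :- a) :* (d′ :- b′) :- (c′ :- a′) :* (d :- b)) :* s)
    refl (ι a) (ι a′) (ι b) (ι b′) (ι c) (ι c′) (ι d) (ι d′) (seq √3 n))
  (cong (λ k → ½ ℚ.* k ℚ.* seq √3 n) (sym k≡)))
  where
  terms = +-cong (wedge≈ Aᶜ Bᶜ) (+-cong (wedge≈ Bᶜ Cᶜ) (+-cong (wedge≈ Cᶜ Dᶜ) (wedge≈ Dᶜ Aᶜ)))

  k≡ : ι (cross (c ℤ.- a) (c′ ℤ.- a′) (d ℤ.- b) (d′ ℤ.- b′)) ≡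
       (ι c ℚ.- ι a) ℚ.* (ι d′ ℚ.- ι b′) ℚ.- (ι c′ ℚ.- ι a′) ℚ.* (ι d ℚ.- ι b)
  k≡ rewrite ι-cross (c ℤ.- a) (c′ ℤ.- a′) (d ℤ.- b) (d′ ℤ.- b′)
           | ι-− c a | ι-− c′ a′ | ι-− d b | ι-− d′ b′ = refl

-- Squaring removes both the absolute value and √3: the area is half of |S| with S = (k/2) √3, so
-- its square is 3 k²/16.
shoelace⇒area² : ∀ {A B C D} k → shoelace A B C D ≈ fromℚ (½ ℚ.* k) * √3 →
  area (A ∷ B ∷ C ∷ D ∷ []) * area (A ∷ B ∷ C ∷ D ∷ []) ≈
  fromℚ (½ ℚ.* ½ ℚ.* (½ ℚ.* ½) ℚ.* 3ℚ ℚ.* (k ℚ.* k))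
shoelace⇒area² {A} {B} {C} {D} k S≈ = begin
  area (A ∷ B ∷ C ∷ D ∷ []) * area (A ∷ B ∷ C ∷ D ∷ [])
    ≈⟨ pointwise (λ n → trans
         (solve 1 (λ s → con ½ :* s :* (con ½ :* s) := con (½ ℚ.* ½) :* (s :* s)) refl ℚ.∣ seq S n ∣)
         (cong (½ ℚ.* ½ ℚ.*_) (∣p∣*∣p∣≡p*p (seq S n)))) ⟩
  fromℚ (½ ℚ.* ½) * (S * S)
    ≈⟨ *-cong ≈-refl (*-cong S≈ S≈) ⟩
  fromℚ (½ ℚ.* ½) * (fromℚ (½ ℚ.* k) * √3 * (fromℚ (½ ℚ.* k) * √3))
    ≈⟨ pointwise (λ n → solve 2 (λ k s →
         con (½ ℚ.* ½) :* (con ½ :* k :* s :* (con ½ :* k :* s)) :=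
         -- The summand 0 gives the product the shape required by `fromℚ+√3²-multiple`.
         con 0ℚ :+ con (½ ℚ.* ½ ℚ.* (½ ℚ.* ½)) :* (k :* k) :* (s :* s)) refl k (seq √3 n)) ⟩
  fromℚ 0ℚ + fromℚ (½ ℚ.* ½ ℚ.* (½ ℚ.* ½) ℚ.* (k ℚ.* k)) * (√3 * √3)
    ≈⟨ fromℚ+√3²-multiple 0ℚ (½ ℚ.* ½ ℚ.* (½ ℚ.* ½) ℚ.* (k ℚ.* k)) ⟩
  fromℚ (0ℚ ℚ.+ ½ ℚ.* ½ ℚ.* (½ ℚ.* ½) ℚ.* (k ℚ.* k) ℚ.* 3ℚ)
    ≡⟨ cong fromℚ (solve 1 (λ x → con 0ℚ :+ con (½ ℚ.* ½ ℚ.* (½ ℚ.* ½)) :* x :* con 3ℚ :=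
         con (½ ℚ.* ½ ℚ.* (½ ℚ.* ½) ℚ.* 3ℚ) :* x) refl (k ℚ.* k)) ⟩
  fromℚ (½ ℚ.* ½ ℚ.* (½ ℚ.* ½) ℚ.* 3ℚ ℚ.* (k ℚ.* k)) ∎
  where S = shoelace A B C D

area² : ∀ {A B C D a a′ b b′ c c′ d d′} →
  Coordinates A a a′ → Coordinates B b b′ → Coordinates C c c′ → Coordinates D d d′ →
  let k = ι (cross (c ℤ.- a) (c′ ℤ.- a′) (d ℤ.- b) (d′ ℤ.- b′)) in
  area (A ∷ B ∷ C ∷ D ∷ []) * area (A ∷ B ∷ C ∷ D ∷ []) ≈
  fromℚ (½ ℚ.* ½ ℚ.* (½ ℚ.* ½) ℚ.* 3ℚ ℚ.* (k ℚ.* k))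
area² {A} {B} {C} {D} {a} {a′} {b} {b′} {c} {c′} {d} {d′} Aᶜ Bᶜ Cᶜ Dᶜ =
  shoelace⇒area² {A} {B} {C} {D} (ι (cross (c ℤ.- a) (c′ ℤ.- a′) (d ℤ.- b) (d′ ℤ.- b′)))
    (shoelace≈ Aᶜ Bᶜ Cᶜ Dᶜ)

-- Equability as an equation between integers, and the contradiction.

perimeter² : ∀ {A B C D} → Rhombus A B C D →
  let P = A ∷ B ∷ C ∷ D ∷ [] in
  perimeter P * perimeter P ≈ fromℚ (ι (+ 16)) * (dist A B * dist A B)
perimeter² {A} {B} {C} {D} rh = begin
  p * p                                            ≈⟨ *-cong p≈ p≈ ⟩
  (s + (s + (s + s))) * (s + (s + (s + s)))        ≈⟨ pointwise (λ n → solve 1 (λ s →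
                                                        (s :+ (s :+ (s :+ s))) :* (s :+ (s :+ (s :+ s))) :=
                                                        con (ι (+ 16)) :* (s :* s)) refl (seq s n)) ⟩
  fromℚ (ι (+ 16)) * (s * s)                       ∎
  where
  p = perimeter (A ∷ B ∷ C ∷ D ∷ [])
  s = dist A B
  open Rhombus rh
  BC≈ = ≈-sym (≃⇒≈ AB≃BC)
  CD≈ = ≈-trans (≈-sym (≃⇒≈ BC≃CD)) BC≈
  DA≈ = ≈-trans (≈-sym (≃⇒≈ CD≃DA)) CD≈
  p≈ : p ≈ s + (s + (s + s))
  -- The sum inside `perimeter` and the local `_+_` have the same terms and differ only in their
  -- proofs of the Cauchy property.
  p≈ = ≈-trans {p} {s + (dist B C + (dist C D + dist D A))} (pointwise λ _ → refl)
    (+-cong ≈-refl (+-cong BC≈ (+-cong CD≈ DA≈)))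

equable⇒256n≡3k² : ∀ {A B C D a a′ b b′ c c′ d d′} →
  Coordinates A a a′ → Coordinates B b b′ → Coordinates C c c′ → Coordinates D d d′ →
  Rhombus A B C D → Equable (A ∷ B ∷ C ∷ D ∷ []) →
  let k = cross (c ℤ.- a) (c′ ℤ.- a′) (d ℤ.- b) (d′ ℤ.- b′) in
  + 256 ℤ.* norm (a ℤ.- b) (a′ ℤ.- b′) ≡ + 3 ℤ.* (k ℤ.* k)
equable⇒256n≡3k² {A} {B} {C} {D} {a} {a′} {b} {b′} {c} {c′} {d} {d′} Aᶜ Bᶜ Cᶜ Dᶜ rh eq =
  ι-injective (clear (norm (a ℤ.- b) (a′ ℤ.- b′)) (cross (c ℤ.- a) (c′ ℤ.- a′) (d ℤ.- b) (d′ ℤ.- b′))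
    (fromℚ-injective (≈-trans (≈-sym (≈-trans perimeter²≈ sides²≈)) (≈-trans squares area²≈))))
  where
  equable = ≃⇒≈ {perimeter (A ∷ B ∷ C ∷ D ∷ [])} {area (A ∷ B ∷ C ∷ D ∷ [])} eq
  squares = *-cong equable equable
  perimeter²≈ = perimeter² {A} {B} {C} {D} rh
  sides²≈ = ≈-trans (*-cong (≈-refl {fromℚ (ι (+ 16))}) (dist²≈norm {A} {B} {a} {a′} {b} {b′} Aᶜ Bᶜ))
    (fromℚ-* (ι (+ 16)) (ι (norm (a ℤ.- b) (a′ ℤ.- b′))))
  area²≈ = area² {A} {B} {C} {D} {a} {a′} {b} {b′} {c} {c′} {d} {d′} Aᶜ Bᶜ Cᶜ Dᶜ

  -- The squares give 16 n = 3 k²/16 over ℚ; a further factor 16 clears the denominator and produces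
  -- 256.
  clear : ∀ n k → ι (+ 16) ℚ.* ι n ≡ ½ ℚ.* ½ ℚ.* (½ ℚ.* ½) ℚ.* 3ℚ ℚ.* (ι k ℚ.* ι k) →
          ι (+ 256 ℤ.* n) ≡ ι (+ 3 ℤ.* (k ℤ.* k))
  clear n k eq rewrite ι-* (+ 256) n | ι-* (+ 3) (k ℤ.* k) | ι-* k k =
    trans (solve 1 (λ n → con (ι (+ 256)) :* n := con (ι (+ 16)) :* (con (ι (+ 16)) :* n)) refl (ι n))
    (trans (cong (ι (+ 16) ℚ.*_) eq)
      (solve 1 (λ x → con (ι (+ 16)) :* (con (½ ℚ.* ½ ℚ.* (½ ℚ.* ½) ℚ.* 3ℚ) :* x) := con 3ℚ :* x)
        refl (ι k ℚ.* ι k)))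

-- Both sides of the collinearity equation acquire a vanishing factor. This contradicts `¬ABC` once
-- the norm of the side AB is known to be 0.
coincident⇒collinear : ∀ {A B a b} C → Coordinates A a b → Coordinates B a b → Collinear A B C
coincident⇒collinear {A} {B} C Aᶜ Bᶜ = ≈⇒≃ (begin
  (re B - re A) * (im C - im A)     ≈⟨ *-cong (−-cong re≈re ≈-refl) ≈-refl ⟩
  (re A - re A) * (im C - im A)     ≈⟨ pointwise (λ n → solve 4 (λ x y u v →
                                         (x :- x) :* (v :- y) := (u :- x) :* (y :- y)) refl
                                         (seq (re A) n) (seq (im A) n) (seq (re C) n) (seq (im C) n)) ⟩
  (re C - re A) * (im A - im A)     ≈⟨ *-cong ≈-refl (−-cong im≈im ≈-refl) ⟨
  (re C - re A) * (im B - im A)     ∎)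
  where
  re≈re = ≈-trans (re≈ Bᶜ) (≈-sym (re≈ Aᶜ))
  im≈im = ≈-trans (im≈ Bᶜ) (≈-sym (im≈ Aᶜ))

corollary1 : ∀ (A B C D : ℂ) →
    A ∈ℤ[ω] → B ∈ℤ[ω] → C ∈ℤ[ω] → D ∈ℤ[ω] →
    Rhombus A B C D → ¬ Equable (A ∷ B ∷ C ∷ D ∷ [])
corollary1 A B C D (a , a′ , A≃) (b , b′ , B≃) (c , c′ , C≃) (d , d′ , D≃) rh eq =
  ¬ABC (coincident⇒collinear C Aᶜ (subst₂ (Coordinates B) (sym a≡b) (sym a′≡b′) Bᶜ))
  where
  open Rhombus rh
  Aᶜ = coordinates A≃
  Bᶜ = coordinates B≃
  Cᶜ = coordinates C≃
  Dᶜ = coordinates D≃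
  a≡b×a′≡b′ = Arithmetic.noEquableRhombus a a′ b b′ c c′ d d′
    (sides⇒norms Aᶜ Bᶜ Bᶜ Cᶜ AB≃BC) (sides⇒norms Bᶜ Cᶜ Cᶜ Dᶜ BC≃CD) (sides⇒norms Cᶜ Dᶜ Dᶜ Aᶜ CD≃DA)
    (equable⇒256n≡3k² Aᶜ Bᶜ Cᶜ Dᶜ rh eq)
  a≡b = proj₁ a≡b×a′≡b′
  a′≡b′ = proj₂ a≡b×a′≡b′
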